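{- Let $I,J,K$ be spherical subsets of $S$, and let $u\in R(I,J)$, $v\in R(K,J)$ and $w\in R(I,K)$. Fix a reduced expression $\boldsymbol{v}$ for $v$ and, for each $m\in M_K(J,v)$, a reduced expression $\boldsymbol{m}$ for $m$. Then $$c_{u,v}^w(I,J,K)=\sum_{\gamma}q(\gamma),$$ where the sum is over all pointed pregalleries $\gamma$ of type $\boldsymbol{m}\boldsymbol{v}$ (the concatenation of $\boldsymbol{m}$ and $\boldsymbol{v}$), for some $m\in M_K(J,v)$, starting at $w$ and with $\mathrm{end}(\gamma)\in W_IuW_J$.
   Context: $(W,S)$ is a Coxeter system with $S$ finite and length $\ell$. For $I\subseteq S$, $W_I=\langle I\rangle$; $I$ is spherical if $W_I$ is finite. $R(I,J)$ is the set of minimal-length representatives of double cosets $W_IwW_J$. For $v\in R(K,J)$, $M_K(J,v)$ is the set of minimal-length representatives of the left cosets in $W_K/(W_K\cap vW_Jv^{ -1})$. $X$ is a locally finite building of type $(W,S)$, chamber set $\mathcal{C}$, Weyl distance $\delta$, regular with parameters $q_s$ (each cotype-$\{s\}$ panel lies in $q_s+1$ chambers). Simplices have cotypes (complement of type); $X_I$ = cotype-$I$ simplices; $\mathcal{C}(A)$ = chambers containing $A$; for $A\in X_I$, $B\in X_J$, $\delta(A,B)$ is the element of $R(I,J)$ in the double coset $\delta(\mathcal{C}(A)\times\mathcal{C}(B))$; $F(A,J,u)=\{D\in X_J:\delta(A,D)=u\}$. The number $|F(A,J,u)\cap F(B,J,v)|$ is the same for all $A\in X_I$, $B\in X_K$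 with $\delta(A,B)=w$, and is denoted $c_{u,v}^w(I,J,K)$. A pointed pregallery of type $(s_1,\ldots,s_n)$ is a sequence $\gamma=(w_0,s_1,w_1,\ldots,s_n,w_n)$, $w_j\in W$, with $w_j\in\{w_{j-1},w_{j-1}s_j\}$, and $\ell(w_{j-1}s_j)<\ell(w_{j-1})$ whenever $w_{j-1}=w_j$; it starts at $w_0$, $\mathrm{end}(\gamma)=w_n$. Set $\alpha_s(\gamma)=|\{j:s_j=s,\ \ell(w_{j-1})<\ell(w_j)\}|$, $\sigma_s(\gamma)=|\{j:s_j=s,\ w_j=w_{j-1}\}|$, $q(\gamma)=\prod_{s}q_s^{\alpha_s(\gamma)}(q_s-1)^{\sigma_s(\gamma)}$. -}

module Defs where

open import Level using (Level; _⊔_) renaming (suc to lsuc)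
open import Algebra.Bundles using (Group)
open import Algebra.Morphism.Structures using (module GroupMorphisms)
open import Data.Nat using (ℕ; zero; suc; _≤_; _<_)
open import Data.Fin using (Fin)
open import Data.Fin.Subset using (Subset; _∈_)
open import Data.List using (List; []; _∷_; length; map; foldr; _++_)
open import Data.List.Relation.Unary.All using (All)
open import Data.List.Relation.Unary.Any using (Any)
open import Data.List.Relation.Unary.AllPairs using (AllPairs)
open import Data.List.Relation.Unary.Unique.Propositional using (Unique)
open import Data.List.Relation.Binary.Pointwise using (Pointwise)
open import Data.List.Membership.Propositional renaming (_∈_ to _∈ₗ_)
open import Data.Product using (Σ; ∃; ∃-syntax; _×_; _,_; proj₁; proj₂)
open import Data.Sum using (_⊎_)
open import Data.Integer as ℤ using (ℤ; +_)
open import Relation.Nullary using (¬_)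
open import Relation.Binary.PropositionalEquality using (_≡_)

module _ {c ℓ} (H : Group c ℓ) where
  open Group H
  gpow : Carrier → ℕ → Carrier
  gpow x zero    = ε
  gpow x (suc k) = x ∙ gpow x k

module Cox {c ℓ} (W : Group c ℓ) {n : ℕ} (gen : Fin n → Group.Carrier W) where
  open Group W

  Word : Set
  Word = List (Fin n)

  eval : Word → Carrier
  eval []      = ε
  eval (i ∷ w) = gen i ∙ eval w

  -- (W,S) is a Coxeter system: S generates W, consists of distinct
  -- non-identity involutions, and W has the Coxeter presentation
  -- < S | (st)^{m_st} = 1 > with m_st the order of st (universal property).
  record IsCoxeterSystem : Set (lsuc (c ⊔ ℓ)) where
    field
      involution : ∀ i → (gen i ∙ gen i) ≈ ε
      nonTrivial : ∀ i → ¬ (gen i ≈ ε)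
      distinct   : ∀ i j → gen i ≈ gen j → i ≡ j
      generates  : ∀ x → ∃[ w ] (eval w ≈ x)
      universal  : (H : Group c ℓ) (f : Fin n → Group.Carrier H) →
                   (∀ i j k → gpow W (gen i ∙ gen j) k ≈ ε →
                      Group._≈_ H (gpow H (Group._∙_ H (f i) (f j)) k) (Group.ε H)) →
                   Σ (Carrier → Group.Carrier H) λ φ →
                     GroupMorphisms.IsGroupHomomorphism (Group.rawGroup W) (Group.rawGroup H) φ
                     × (∀ i → Group._≈_ H (φ (gen i)) (f i))

  IsLength : Carrier → ℕ → Set _
  IsLength x k = (∃[ w ] (length w ≡ k × eval w ≈ x)) × (∀ w → eval w ≈ x → k ≤ length w)

  LenLt : Carrier → Carrier → Set _
  LenLt x y = ∀ a b → IsLength x a → IsLength y b → a < b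

  LenLe : Carrier → Carrier → Set _
  LenLe x y = ∀ a b → IsLength x a → IsLength y b → a ≤ b

  Reduced : Carrier → Word → Set _
  Reduced x w = eval w ≈ x × IsLength x (length w)

  InPar : Subset n → Carrier → Set _
  InPar I x = ∃[ w ] (All (_∈ I) w × eval w ≈ x)

  InDouble : Subset n → Subset n → Carrier → Carrier → Set _
  InDouble I J u x = ∃[ y ] ∃[ z ] (InPar I y × InPar J z × x ≈ (y ∙ u) ∙ z)

  Spherical : Subset n → Set _
  Spherical I = ∃[ L ] (∀ x → InPar I x → Any (x ≈_) L)

  InR : Subset n → Subset n → Carrier → Set _
  InR I J w = ∀ x y → InPar I x → InPar J y → LenLe w ((x ∙ w) ∙ y)

  InM : Subset n → Subset n → Carrier → Carrier → Set _
  InM K J v m = InPar K m ×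
    (∀ x → InPar K x → InPar J ((v ⁻¹ ∙ x) ∙ v) → LenLe m (m ∙ x))

  -- Locally finite building of type (W,S) (W-metric definition), regular
  -- with parameters q: each s-panel has exactly q_s + 1 chambers.
  record Building (q : Fin n → ℕ) (b : Level) : Set (lsuc b ⊔ c ⊔ ℓ) where
    field
      Ch   : Set b
      δ    : Ch → Ch → Carrier
      wd1  : ∀ x y → (δ x y ≈ ε → x ≡ y) × (x ≡ y → δ x y ≈ ε)
      wd2  : ∀ x y x' i → δ x' x ≈ gen i →
             ((δ x' y ≈ (gen i ∙ δ x y)) ⊎ (δ x' y ≈ δ x y))
             × (LenLt (δ x y) (gen i ∙ δ x y) → δ x' y ≈ (gen i ∙ δ x y))
      wd3  : ∀ x y i → ∃[ x' ] (δ x' x ≈ gen i × δ x' y ≈ (gen i ∙ δ x y))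
      regular : ∀ x i → ∃[ P ] (Unique P × length P ≡ suc (q i) ×
                  (∀ y → (y ∈ₗ P → (δ x y ≈ ε ⊎ δ x y ≈ gen i))
                       × ((δ x y ≈ ε ⊎ δ x y ≈ gen i) → y ∈ₗ P)))

  module Simp {q : Fin n → ℕ} {b : Level} (X : Building q b) where
    open Building X
    -- A simplex of cotype I is represented by any chamber x containing it;
    -- C(A) = { y | δ(x,y) ∈ W_I }.  Same simplex of cotype I: SameSimp I.
    SameSimp : Subset n → Ch → Ch → Set _
    SameSimp I x y = InPar I (δ x y)

    -- δ(A,B) = u  (A of cotype I represented by x, B of cotype J by y),
    -- i.e. u lies in δ(C(A) × C(B)).
    DistIs : Subset n → Subset n → Ch → Ch → Carrier → Set _
    DistIs I J x y u = ∃[ x' ] ∃[ y' ] (InPar I (δ x x') × InPar J (δ y y') × δ x' y' ≈ u)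

    -- Ds is a duplicate-free enumeration (as cotype-J simplices) of
    -- F(A,J,u) ∩ F(B,J,v), A of cotype I rep. by a, B of cotype K rep. by bb.
    EnumF : Subset n → Subset n → Subset n → Ch → Ch → Carrier → Carrier → List Ch → Set _
    EnumF I J K a bb u v Ds =
      All (λ d → DistIs I J a d u × DistIs K J bb d v) Ds
      × AllPairs (λ d d' → ¬ SameSimp J d d') Ds
      × (∀ d → DistIs I J a d u → DistIs K J bb d v → Any (SameSimp J d) Ds)

  -- Pointed pregalleries starting at a fixed w0: the list of pairs (s_j , w_j).
  Steps : Set c
  Steps = List (Fin n × Carrier)

  module Preg (q : Fin n → ℕ) where
    data StepW (w : Carrier) (i : Fin n) (w' : Carrier) : ℤ → Set (c ⊔ ℓ) where
      up   : w' ≈ (w ∙ gen i) → LenLt w w' → StepW w i w' (+ q i)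
      stay : w' ≈ w → LenLt (w ∙ gen i) w → StepW w i w' (+ q i ℤ.- + 1)
      down : w' ≈ (w ∙ gen i) → LenLt w' w → StepW w i w' (+ 1)

    -- PregW w0 γ z : γ is a pointed pregallery starting at w0 and q(γ) = z
    data PregW : Carrier → Steps → ℤ → Set (c ⊔ ℓ) where
      done : ∀ {w} → PregW w [] (+ 1)
      step : ∀ {w i w' γ a z} → StepW w i w' a → PregW w' γ z →
             PregW w ((i , w') ∷ γ) (a ℤ.* z)

    type : Steps → Word
    type = map proj₁

    endP : Carrier → Steps → Carrier
    endP w0 []             = w0
    endP w0 ((_ , w) ∷ γ) = endP w γ

    PregEq : Steps → Steps → Set _
    PregEq = Pointwise (λ p p' → proj₁ p ≡ proj₁ p' × proj₂ p ≈ proj₂ p')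

  sumℤ : List ℤ → ℤ
  sumℤ = foldr ℤ._+_ (+ 0)

  MReps : Subset n → Subset n → Carrier → List (Carrier × Word) → Set _
  MReps K J v ms =
    All (λ p → InM K J v (proj₁ p) × Reduced (proj₁ p) (proj₂ p)) ms
    × AllPairs (λ p p' → ¬ (proj₁ p ≈ proj₁ p')) ms
    × (∀ m → InM K J v m → Any (λ p → proj₁ p ≈ m) ms)

  module Sum (q : Fin n → ℕ) where
    open Preg q
    Good : Subset n → Subset n → Carrier → Carrier → Word → List (Carrier × Word) → Steps → ℤ → Set _
    Good I J u w vw ms γ z =
      PregW w γ z × Any (λ p → type γ ≡ proj₂ p ++ vw) ms × InDouble I J u (endP w γ)

    EnumPreg : Subset n → Subset n → Carrier → Carrier → Word → List (Carrier × Word) → List (Steps × ℤ) → Set _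
    EnumPreg I J u w vw ms Γ =
      All (λ p → Good I J u w vw ms (proj₁ p) (proj₂ p)) Γ
      × AllPairs (λ p p' → ¬ PregEq (proj₁ p) (proj₁ p')) Γ
      × (∀ γ z → Good I J u w vw ms γ z → Any (λ p → PregEq γ (proj₁ p)) Γ)

{-# OPTIONS --safe #-}
module Submission where

-- Choose x₀ ∈ A and y₀ ∈ B with δ(x₀,y₀) = w.  A simplex D with δ(B,D) = v contains
-- exactly one chamber z with δ(y₀,z) = mv for some m ∈ M_K(J,v), namely the one nearest
-- to y₀, and then δ(A,D) = u means δ(x₀,z) ∈ W_I u W_J.  The word 𝐦𝐯 is reduced, so z is
-- the end of exactly one gallery of type 𝐦𝐯 from y₀.  Recording the distances from x₀
-- along galleries gives a pregallery, and q(γ) counts the galleries that lie over γ.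
--
-- The input about W is that a word is reduced exactly if its reflections are pairwise
-- distinct.  This rests on the parity with which a reflection occurs in a word
-- depending only on the value of the word, which is checked on the Coxeter relators.
--
-- Neither equality in W nor membership in W_I u W_J is decidable, but the claim, an
-- equation between integers, is.  So all case distinctions are made under ¬ ¬.

open import Defs
open import Level using (Level; _⊔_; Lift; lift; lower)
open import Algebra.Bundles using (Group)
open import Algebra.Morphism.Structures using (module GroupMorphisms)
open import Data.Bool using (Bool; true; false; not; _xor_)
open import Data.Bool.Properties using (not-involutive; not-¬; xor-same)
open import Data.Nat using (ℕ; zero; suc; _+_; _≤_; _<_; z≤n; s≤s)
import Data.Nat.Properties as ℕ
open import Data.Fin using (Fin)
open import Data.Fin.Subset using (Subset; _∈_)
open import Data.List using (List; []; _∷_; _++_; [_]; length; map; foldr; reverse; concatMap)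
import Data.List.Properties as List
open import Data.List.Relation.Unary.All as All using (All; []; _∷_)
import Data.List.Relation.Unary.All.Properties as All
open import Data.List.Relation.Unary.Any as Any using (Any; here; there)
import Data.List.Relation.Unary.Any.Properties as Any
open import Data.List.Relation.Unary.AllPairs as AllPairs using (AllPairs; []; _∷_)
import Data.List.Relation.Unary.AllPairs.Properties as AllPairs
open import Data.List.Relation.Unary.Unique.Propositional using (Unique)
import Data.List.Relation.Unary.Unique.Propositional.Properties as Unique
open import Data.List.Membership.Propositional using (lose; find) renaming (_∈_ to _∈ₗ_)
open import Data.List.Membership.Propositional.Properties using (∈-concatMap⁺; ∈-concatMap⁻; ∈-++⁺ˡ; ∈-++⁺ʳ)
open import Data.List.Relation.Binary.Disjoint.Propositional using (Disjoint)
open import Data.List.Relation.Binary.Pointwise as Pointwise using (Pointwise; []; _∷_)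
open import Data.List.Relation.Binary.Permutation.Propositional using (_↭_; ↭⇒↭ₛ; prep; swap; ↭-refl; ↭-sym)
open import Data.List.Relation.Binary.Permutation.Propositional.Properties
  using (All-resp-↭; Any-resp-↭; ↭-reverse; ↭-length)
import Data.List.Relation.Binary.Permutation.Setoid.Properties as ↭ₛ
open import Data.Product using (∃; ∃₂; _×_; _,_; proj₁; proj₂)
open import Data.Sum using (_⊎_; inj₁; inj₂)
open import Data.Empty using (⊥; ⊥-elim)
open import Data.Unit using (⊤; tt)
open import Data.Integer as ℤ using (ℤ; +_)
import Data.Integer.Properties as ℤ
open import Function using (case_of_)
open import Relation.Nullary using (¬_; yes; no; contradiction; decidable-stable; ¬¬-excluded-middle)
open import Relation.Binary.PropositionalEquality as ≡ using (_≡_; refl; cong; cong₂; subst)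

-- `IsCoxeterSystem` gives only the universal property, so exchange and deletion have to be derived.
-- The reflections of a relator (st)^k are (st)^j s for j < 2k, and (st)^k = 1 makes the second half
-- repeat the first; hence parities depend only on the value. For a word with distinct reflections
-- the parities recover the set of its reflections, and thus its length. A repeated reflection lets
-- letters be deleted. This is why 𝐦𝐯, even when followed by a reduced word in J, is reduced: a
-- coincidence would shorten v within W_K v W_J, or m within m(W_K ∩ vW_Jv⁻¹).
--
-- The weights come from a single panel. Of the q_s chambers s-adjacent to y, all are farther from
-- x₀ if s is an ascent; otherwise exactly one is nearer and q_s - 1 stay at the distance of y.
-- These are the factors q_s, 1 and q_s - 1 of the steps up, down and stay.
--
-- Since existence is mostly known only under double negation, bijections are replaced by matchings
-- of finite lists: relations in which no two entries share a partner and every entry has one up to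
-- double negation.

private variable
  a b p r : Level
  A : Set a
  B : Set b

-- Reasoning under double negation

infixl 1 _>>=_
_>>=_ : ¬ ¬ A → (A → ¬ ¬ B) → ¬ ¬ B
(m >>= f) k = m λ x → f x k

pure : A → ¬ ¬ A
pure x k = k x

¬¬-All : {P : A → Set p} {xs : List A} → All (λ x → ¬ ¬ P x) xs → ¬ ¬ All P xs
¬¬-All []         = pure []
¬¬-All (px ∷ pxs) = do
  y  ← px
  ys ← ¬¬-All pxs
  pure (y ∷ ys)

¬¬-none-or-any : (P : A → Set p) (xs : List A) → ¬ ¬ (All (λ x → ¬ P x) xs ⊎ Any P xs)
¬¬-none-or-any P []       = pure (inj₁ [])
¬¬-none-or-any P (x ∷ xs) = ¬¬-excluded-middle >>= λ where
  (yes px) → pure (inj₂ (here px))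
  (no ¬px) → ¬¬-none-or-any P xs >>= λ where
    (inj₁ none) → pure (inj₁ (¬px ∷ none))
    (inj₂ any)  → pure (inj₂ (there any))

-- Finite sums and matchings

sumBy : (A → ℤ) → List A → ℤ
sumBy f xs = foldr ℤ._+_ (+ 0) (map f xs)

sumBy-++ : (f : A → ℤ) (xs ys : List A) → sumBy f (xs ++ ys) ≡ sumBy f xs ℤ.+ sumBy f ys
sumBy-++ f []       ys = ≡.sym (ℤ.+-identityˡ _)
sumBy-++ f (x ∷ xs) ys = ≡.trans (cong (ℤ._+_ (f x)) (sumBy-++ f xs ys)) (≡.sym (ℤ.+-assoc (f x) _ _))

sumBy-1 : (xs : List A) → sumBy (λ _ → + 1) xs ≡ + length xs
sumBy-1 []       = refl
sumBy-1 (x ∷ xs) = cong (ℤ._+_ (+ 1)) (sumBy-1 xs)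

sumBy-↭ : (f : A → ℤ) {xs ys : List A} → xs ↭ ys → sumBy f xs ≡ sumBy f ys
sumBy-↭ f _↭_.refl        = refl
sumBy-↭ f (prep x p)      = cong (ℤ._+_ (f x)) (sumBy-↭ f p)
sumBy-↭ f (swap x y p)    = ≡.trans (cong (λ z → f x ℤ.+ (f y ℤ.+ z)) (sumBy-↭ f p))
  (≡.trans (≡.sym (ℤ.+-assoc (f x) (f y) _))
  (≡.trans (cong (ℤ._+ _) (ℤ.+-comm (f x) (f y))) (ℤ.+-assoc (f y) (f x) _)))
sumBy-↭ f (_↭_.trans p q) = ≡.trans (sumBy-↭ f p) (sumBy-↭ f q)

pick : {P : A → Set p} {xs : List A} → Any P xs → ∃₂ λ x xs′ → P x × xs ↭ x ∷ xs′
pick (here {x} {xs} px) = x , xs , px , ↭-refl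
pick (there {x} any) with pick any
... | y , ys , py , perm = y , x ∷ ys , py , _↭_.trans (prep x perm) (swap x y ↭-refl)

AllPairs-resp-↭ : {R : A → A → Set r} → (∀ {x y} → R x y → R y x) →
                  {xs ys : List A} → xs ↭ ys → AllPairs R xs → AllPairs R ys
AllPairs-resp-↭ {A = A} {R = R} R-sym perm =
  ↭ₛ.AllPairs-resp-↭ (≡.setoid A) R-sym ((λ { refl Rxy → Rxy }) , (λ { refl Rxy → Rxy })) (↭⇒↭ₛ perm)

Separates : (A → B → Set r) → A → A → Set _
Separates R x x′ = ∀ y → R x y → R x′ y → ⊥

-- Removing `x` together with its partner `y` leaves a matching: by separation no other entry was
-- matched with either of them. The double negations are absorbed by the decidable equation of
-- integers.
sumBy-match : (R : A → B → Set r) (f : A → ℤ) (g : B → ℤ) → (∀ {x y} → R x y → f x ≡ g y) →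
              (xs : List A) (ys : List B) →
              AllPairs (Separates R) xs → AllPairs (Separates λ y x → R x y) ys →
              All (λ x → ¬ ¬ Any (R x) ys) xs → All (λ y → ¬ ¬ Any (λ x → R x y) xs) ys →
              sumBy f xs ≡ sumBy g ys
sumBy-match R f g f≡g []       []       _ _ _ _        = refl
sumBy-match R f g f≡g []       (y ∷ ys) _ _ _ (my ∷ _) = ⊥-elim (my λ ())
sumBy-match R f g f≡g (x ∷ xs) ys (dx ∷ dxs) dys (mx ∷ mxs) mys = decidable-stable (_ ℤ.≟ _) do
  any ← mx
  case pick any of λ where
    (y , ys′ , Rxy , perm) → case AllPairs-resp-↭ (λ d z s t → d z t s) perm dys of λ where
      (dy ∷ dys′) → pure (≡.trans (cong₂ ℤ._+_ (f≡g Rxy)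
        (sumBy-match R f g f≡g xs ys′ dxs dys′
          (All.zipWith (λ (d , m) → m >>= λ any′ → case Any-resp-↭ perm any′ of λ where
              (here Rx′y)  → ⊥-elim (d y Rxy Rx′y)
              (there any″) → pure any″) (dx , mxs))
          (All.zipWith (λ (d , m) → m >>= λ where
              (here Rxy′)  → ⊥-elim (d x Rxy Rxy′)
              (there any′) → pure any′) (dy , All.tail (All-resp-↭ perm mys)))))
        (≡.sym (sumBy-↭ g perm)))

length-match : (R : A → B → Set r) (xs : List A) (ys : List B) →
               AllPairs (Separates R) xs → AllPairs (Separates λ y x → R x y) ys →
               All (λ x → ¬ ¬ Any (R x) ys) xs → All (λ y → ¬ ¬ Any (λ x → R x y) xs) ys →
               length xs ≡ length ys
length-match R xs ys dxs dys mxs mys = ℤ.+-injective (≡.trans (≡.sym (sumBy-1 xs)) (≡.trans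
  (sumBy-match R (λ _ → + 1) (λ _ → + 1) (λ _ → refl) xs ys dxs dys mxs mys) (sumBy-1 ys)))

any×all : {P : A → Set p} {Q : A → Set r} {xs : List A} → Any P xs → All Q xs → Any (λ x → P x × Q x) xs
any×all (here p)  (q ∷ _)  = here (p , q)
any×all (there p) (_ ∷ qs) = there (any×all p qs)

allPairs×all : {R : A → A → Set r} {Q : A → Set p} {xs : List A} →
               AllPairs R xs → All Q xs → AllPairs (λ x y → R x y × Q x × Q y) xs
allPairs×all []       []       = []
allPairs×all (r ∷ rs) (q ∷ qs) = All.zipWith (λ (r , q′) → r , q , q′) (r , qs) ∷ allPairs×all rs qs

-- Coxeter groups: words and their values

module Coxeter {c ℓ : Level} (W : Group c ℓ) {n : ℕ} (gen : Fin n → Group.Carrier W)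
               (cox : Cox.IsCoxeterSystem W gen) where

  open Group W hiding (refl)
  open Cox W gen
  open IsCoxeterSystem cox
  open import Algebra.Properties.Group W
  open import Algebra.Properties.Monoid monoid using (cancelˡ; cancelʳ; cancelᶜ)
  open import Relation.Binary.Reasoning.Setoid setoid

  ≈-refl : ∀ {x} → x ≈ x
  ≈-refl = Group.refl W

  gen-cancelˡ : ∀ i x → gen i ∙ (gen i ∙ x) ≈ x
  gen-cancelˡ i = cancelˡ (involution i)

  gen-injective : ∀ i {x y} → gen i ∙ x ≈ gen i ∙ y → x ≈ y
  gen-injective i = ∙-cancelˡ (gen i) _ _

  eval-++ : ∀ v w → eval (v ++ w) ≈ eval v ∙ eval w
  eval-++ []      w = sym (identityˡ _)
  eval-++ (i ∷ v) w = trans (∙-congˡ (eval-++ v w)) (sym (assoc _ _ _))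

  eval-resp : ∀ {v w} → v ≡ w → eval v ≈ eval w
  eval-resp refl = ≈-refl

  eval-reverse : ∀ w → eval (reverse w) ≈ eval w ⁻¹
  eval-reverse []      = sym ε⁻¹≈ε
  eval-reverse (i ∷ w) = begin
    eval (reverse (i ∷ w))             ≈⟨ eval-resp (List.unfold-reverse i w) ⟩
    eval (reverse w ++ [ i ])          ≈⟨ eval-++ (reverse w) [ i ] ⟩
    eval (reverse w) ∙ (gen i ∙ ε)     ≈⟨ ∙-cong (eval-reverse w) (identityʳ _) ⟩
    eval w ⁻¹ ∙ gen i                  ≈⟨ ∙-congˡ (inverseˡ-unique _ _ (involution i)) ⟩
    eval w ⁻¹ ∙ gen i ⁻¹               ≈⟨ ⁻¹-anti-homo-∙ _ _ ⟨
    (gen i ∙ eval w) ⁻¹                ∎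

  -- The Coxeter presentation

  alt : Fin n → Fin n → ℕ → Word
  alt i j zero    = []
  alt i j (suc k) = i ∷ j ∷ alt i j k

  eval-alt : ∀ i j k → eval (alt i j k) ≈ gpow W (gen i ∙ gen j) k
  eval-alt i j zero    = ≈-refl
  eval-alt i j (suc k) = trans (∙-congˡ (∙-congˡ (eval-alt i j k))) (sym (assoc _ _ _))

  infix 4 _~_
  -- The context is built into `relator`, so an invariant needs checking only for the removal of one
  -- relator. The case `i = j`, `k = 1` is the cancellation of ss.
  data _~_ : Word → Word → Set ℓ where
    relator : ∀ v w i j k → gpow W (gen i ∙ gen j) k ≈ ε → v ++ (alt i j k ++ w) ~ v ++ w
    ~-refl  : ∀ {v} → v ~ v
    ~-sym   : ∀ {v w} → v ~ w → w ~ v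
    ~-trans : ∀ {u v w} → u ~ v → v ~ w → u ~ w

  ~-reflexive : ∀ {v w} → v ≡ w → v ~ w
  ~-reflexive refl = ~-refl

  ~-++ʳ : ∀ u {v w} → v ~ w → v ++ u ~ w ++ u
  ~-++ʳ u (relator v w i j k p) = ~-trans
    (~-reflexive (≡.trans (List.++-assoc v (alt i j k ++ w) u) (cong (v ++_) (List.++-assoc (alt i j k) w u))))
    (~-trans (relator v (w ++ u) i j k p) (~-reflexive (≡.sym (List.++-assoc v w u))))
  ~-++ʳ u ~-refl        = ~-refl
  ~-++ʳ u (~-sym p)     = ~-sym (~-++ʳ u p)
  ~-++ʳ u (~-trans p q) = ~-trans (~-++ʳ u p) (~-++ʳ u q)

  ~-++ˡ : ∀ u {v w} → v ~ w → u ++ v ~ u ++ w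
  ~-++ˡ u (relator v w i j k p) = ~-trans (~-reflexive (≡.sym (List.++-assoc u v _)))
    (~-trans (relator (u ++ v) w i j k p) (~-reflexive (List.++-assoc u v w)))
  ~-++ˡ u ~-refl        = ~-refl
  ~-++ˡ u (~-sym p)     = ~-sym (~-++ˡ u p)
  ~-++ˡ u (~-trans p q) = ~-trans (~-++ˡ u p) (~-++ˡ u q)

  ~-inverseˡ : ∀ w → reverse w ++ w ~ []
  ~-inverseˡ []      = ~-refl
  ~-inverseˡ (i ∷ w) = ~-trans
    (~-reflexive (≡.trans (cong (_++ i ∷ w) (List.unfold-reverse i w)) (List.++-assoc (reverse w) [ i ] (i ∷ w))))
    (~-trans (relator (reverse w) w i i 1 (trans (identityʳ _) (involution i))) (~-inverseˡ w))

  ~-inverseʳ : ∀ w → w ++ reverse w ~ []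
  ~-inverseʳ w = subst (λ v → v ++ reverse w ~ []) (List.reverse-involutive w) (~-inverseˡ (reverse w))

  ~-reverse : ∀ {v w} → v ~ w → reverse v ~ reverse w
  ~-reverse {v} {w} p =
    ~-trans (~-reflexive (≡.sym (List.++-identityʳ (reverse v))))
    (~-trans (~-++ˡ (reverse v) (~-sym (~-inverseʳ w)))
    (~-trans (~-reflexive (≡.sym (List.++-assoc (reverse v) w (reverse w))))
    (~-trans (~-++ʳ (reverse w) (~-++ˡ (reverse v) (~-sym p))) (~-++ʳ (reverse w) (~-inverseˡ v)))))

  -- The target for the universal property. Reversal inverts because ss is a relator; `Lift` meets
  -- the universe level that `universal` prescribes.
  Words : Group c ℓ
  Words = record
    { Carrier = Lift c Word
    ; _≈_     = λ v w → lower v ~ lower w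
    ; _∙_     = λ v w → lift (lower v ++ lower w)
    ; ε       = lift []
    ; _⁻¹     = λ w → lift (reverse (lower w))
    ; isGroup = record
      { isMonoid = record
        { isSemigroup = record
          { isMagma = record
            { isEquivalence = record { refl = ~-refl ; sym = ~-sym ; trans = ~-trans }
            ; ∙-cong = λ {v} {v′} {w} {w′} p q → ~-trans (~-++ʳ (lower w) p) (~-++ˡ (lower v′) q) }
          ; assoc = λ u v w → ~-reflexive (List.++-assoc (lower u) (lower v) (lower w)) }
        ; identity = (λ _ → ~-refl) , (λ w → ~-reflexive (List.++-identityʳ (lower w))) }
      ; inverse = (λ w → ~-inverseˡ (lower w)) , (λ w → ~-inverseʳ (lower w))
      ; ⁻¹-cong = ~-reverse } }

  -- The homomorphism `φ` from the universal property sends `eval u` back to the class of `u`, hence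
  -- `eval` is injective on classes.
  presentation : ∀ v w → eval v ≈ eval w → v ~ w
  presentation v w v≈w = ~-trans (~-sym (φ-eval v)) (~-trans (⟦⟧-cong v≈w) (φ-eval w))
    where
    gpow-alt : ∀ i j k → lower (gpow Words (lift (i ∷ j ∷ [])) k) ≡ alt i j k
    gpow-alt i j zero    = refl
    gpow-alt i j (suc k) = cong (λ u → i ∷ j ∷ u) (gpow-alt i j k)

    relations : ∀ i j k → gpow W (gen i ∙ gen j) k ≈ ε → lower (gpow Words (lift (i ∷ j ∷ [])) k) ~ []
    relations i j k p = ~-trans (~-reflexive (≡.trans (gpow-alt i j k) (≡.sym (List.++-identityʳ _))))
                                (relator [] [] i j k p)

    hom = universal Words (λ i → lift [ i ]) relations
    φ   = proj₁ hom
    open GroupMorphisms.IsGroupHomomorphism (proj₁ (proj₂ hom)) using (⟦⟧-cong; homo; ε-homo)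

    φ-eval : ∀ u → lower (φ (eval u)) ~ u
    φ-eval []      = ε-homo
    φ-eval (i ∷ u) = ~-trans (homo (gen i) (eval u))
      (~-trans (~-++ʳ _ (proj₂ (proj₂ hom) i)) (~-++ˡ [ i ] (φ-eval u)))

  -- Parity of the length

  isOdd : ℕ → Bool
  isOdd zero    = false
  isOdd (suc k) = not (isOdd k)

  isOdd-++ : ∀ (v w w′ : Word) → isOdd (length w) ≡ isOdd (length w′) →
             isOdd (length (v ++ w)) ≡ isOdd (length (v ++ w′))
  isOdd-++ []      w w′ p = p
  isOdd-++ (i ∷ v) w w′ p = cong not (isOdd-++ v w w′ p)

  isOdd-alt : ∀ i j k w → isOdd (length (alt i j k ++ w)) ≡ isOdd (length w)
  isOdd-alt i j zero    w = refl
  isOdd-alt i j (suc k) w = ≡.trans (not-involutive _) (isOdd-alt i j k w)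

  -- Relators have even length. Consequently x and xs never have the same length, as
  -- `ascent-or-descent` requires.
  isOdd-~ : ∀ {v w} → v ~ w → isOdd (length v) ≡ isOdd (length w)
  isOdd-~ (relator v w i j k p) = isOdd-++ v (alt i j k ++ w) w (isOdd-alt i j k w)
  isOdd-~ ~-refl                = refl
  isOdd-~ (~-sym p)             = ≡.sym (isOdd-~ p)
  isOdd-~ (~-trans p q)         = ≡.trans (isOdd-~ p) (isOdd-~ q)

  -- Reflections

  conj : Fin n → Carrier → Carrier
  conj i x = gen i ∙ (x ∙ gen i)

  conjW : Word → Carrier → Carrier
  conjW []      x = x
  conjW (i ∷ w) x = conj i (conjW w x)

  -- The reflections s₁ ⋯ sⱼ₋₁ sⱼ sⱼ₋₁ ⋯ s₁ of the word s₁ ⋯ sₖ.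
  refls : Word → List Carrier
  refls []      = []
  refls (i ∷ w) = gen i ∷ map (conj i) (refls w)

  length-refls : ∀ w → length (refls w) ≡ length w
  length-refls []      = refl
  length-refls (i ∷ w) = cong suc (≡.trans (List.length-map (conj i) (refls w)) (length-refls w))

  refls-++ : ∀ v w → refls (v ++ w) ≡ refls v ++ map (conjW v) (refls w)
  refls-++ []      w = ≡.sym (List.map-id (refls w))
  refls-++ (i ∷ v) w = cong (gen i ∷_) (≡.trans (cong (map (conj i)) (refls-++ v w))
    (≡.trans (List.map-++ (conj i) (refls v) _) (cong (map (conj i) (refls v) ++_) (≡.sym (List.map-∘ (refls w))))))

  conj-cong : ∀ i {x y} → x ≈ y → conj i x ≈ conj i y
  conj-cong i p = ∙-congˡ (∙-congʳ p)

  conj-injective : ∀ i {x y} → conj i x ≈ conj i y → x ≈ y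
  conj-injective i p = ∙-cancelʳ (gen i) _ _ (gen-injective i p)

  conjW-cong : ∀ w {x y} → x ≈ y → conjW w x ≈ conjW w y
  conjW-cong []      p = p
  conjW-cong (i ∷ w) p = conj-cong i (conjW-cong w p)

  conjW-injective : ∀ w {x y} → conjW w x ≈ conjW w y → x ≈ y
  conjW-injective []      p = p
  conjW-injective (i ∷ w) p = conjW-injective w (conj-injective i p)

  conj-gen : ∀ i x y → conj i x ∙ (gen i ∙ y) ≈ gen i ∙ (x ∙ y)
  conj-gen i x y = begin
    (gen i ∙ (x ∙ gen i)) ∙ (gen i ∙ y) ≈⟨ assoc _ _ _ ⟩
    gen i ∙ ((x ∙ gen i) ∙ (gen i ∙ y)) ≈⟨ ∙-congˡ (cancelᶜ (involution i) x y) ⟩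
    gen i ∙ (x ∙ y)                     ∎

  conjW-eval : ∀ w x → conjW w x ∙ eval w ≈ eval w ∙ x
  conjW-eval []      x = trans (identityʳ x) (sym (identityˡ x))
  conjW-eval (i ∷ w) x = begin
    conj i (conjW w x) ∙ (gen i ∙ eval w) ≈⟨ conj-gen i _ _ ⟩
    gen i ∙ (conjW w x ∙ eval w)          ≈⟨ ∙-congˡ (conjW-eval w x) ⟩
    gen i ∙ (eval w ∙ x)                  ≈⟨ assoc _ _ _ ⟨
    (gen i ∙ eval w) ∙ x                  ∎

  infix 4 _≋_
  _≋_ : List Carrier → List Carrier → Set _
  _≋_ = Pointwise _≈_

  ≋-refl : ∀ {xs} → xs ≋ xs
  ≋-refl = Pointwise.refl ≈-refl

  ≋-trans : ∀ {xs ys zs} → xs ≋ ys → ys ≋ zs → xs ≋ zs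
  ≋-trans = Pointwise.transitive trans

  ≋-map : ∀ {f g : Carrier → Carrier} → (∀ {x y} → x ≈ y → f x ≈ g y) → ∀ {xs ys} → xs ≋ ys → map f xs ≋ map g ys
  ≋-map f≈g []       = []
  ≋-map f≈g (p ∷ ps) = f≈g p ∷ ≋-map f≈g ps

  -- Reflections of the relators

  progression : Carrier → Carrier → ℕ → List Carrier
  progression x y zero    = []
  progression x y (suc k) = y ∷ progression x (x ∙ y) k

  progression-cong : ∀ {x y y′} k → y ≈ y′ → progression x y k ≋ progression x y′ k
  progression-cong zero    p = []
  progression-cong (suc k) p = p ∷ progression-cong k (∙-congˡ p)

  gpow-comm : ∀ x k → gpow W x k ∙ x ≈ x ∙ gpow W x k
  gpow-comm x zero    = trans (identityˡ x) (sym (identityʳ x))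
  gpow-comm x (suc k) = trans (assoc _ _ _) (∙-congˡ (gpow-comm x k))

  progression-+ : ∀ x y k m → progression x y (k + m) ≋ progression x y k ++ progression x (gpow W x k ∙ y) m
  progression-+ x y zero    m = progression-cong m (sym (identityˡ y))
  progression-+ x y (suc k) m = ≈-refl ∷ ≋-trans (progression-+ x (x ∙ y) k m)
    (Pointwise.++⁺ (≋-refl {progression x (x ∙ y) k})
      (progression-cong m (trans (sym (assoc _ _ _)) (∙-congʳ (gpow-comm x k)))))

  -- With x = st the hypothesis reads y x⁻¹ = x y, as for the reflections of the dihedral group of s
  -- and t. Conjugation by x then takes y to x²y, two places further on.
  conj-progression : ∀ i j y → (y ∙ gen j) ∙ gen i ≈ (gen i ∙ gen j) ∙ y → ∀ k →
                     let x = gen i ∙ gen j in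
                     map (conj i) (map (conj j) (progression x y k)) ≋ progression x (x ∙ (x ∙ y)) k
  conj-progression i j y p zero    = []
  conj-progression i j y p (suc k) = (begin
      gen i ∙ ((gen j ∙ (y ∙ gen j)) ∙ gen i) ≈⟨ ∙-congˡ (assoc _ _ _) ⟩
      gen i ∙ (gen j ∙ ((y ∙ gen j) ∙ gen i)) ≈⟨ assoc _ _ _ ⟨
      (gen i ∙ gen j) ∙ ((y ∙ gen j) ∙ gen i) ≈⟨ ∙-congˡ p ⟩
      (gen i ∙ gen j) ∙ ((gen i ∙ gen j) ∙ y) ∎)
    ∷ conj-progression i j _ (begin
      ((x ∙ y) ∙ gen j) ∙ gen i ≈⟨ ∙-congʳ (assoc _ _ _) ⟩
      (x ∙ (y ∙ gen j)) ∙ gen i ≈⟨ assoc _ _ _ ⟩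
      x ∙ ((y ∙ gen j) ∙ gen i) ≈⟨ ∙-congˡ p ⟩
      x ∙ (x ∙ y)               ∎) k
    where x = gen i ∙ gen j

  refls-alt : ∀ i j k → refls (alt i j k) ≋ progression (gen i ∙ gen j) (gen i) (k + k)
  refls-alt i j zero    = []
  refls-alt i j (suc k) = subst (λ m → refls (alt i j (suc k)) ≋ progression x (gen i) (suc m)) (≡.sym (ℕ.+-suc k k))
    (≈-refl ∷ sym (assoc _ _ _) ∷ ≋-trans
      (≋-map (conj-cong i) (≋-map (conj-cong j) (refls-alt i j k)))
      (conj-progression i j (gen i) ≈-refl (k + k)))
    where x = gen i ∙ gen j

  Doubled : List Carrier → Set _
  Doubled xs = ∃ λ ys → xs ≋ ys ++ ys

  -- The entries (st)^j s and (st)^(j+k) s coincide once (st)^k = 1.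
  doubled-refls-alt : ∀ i j k → gpow W (gen i ∙ gen j) k ≈ ε → Doubled (refls (alt i j k))
  doubled-refls-alt i j k p = ys , ≋-trans (refls-alt i j k) (≋-trans (progression-+ x (gen i) k k)
      (Pointwise.++⁺ (≋-refl {ys}) (progression-cong k (trans (∙-congʳ p) (identityˡ _)))))
    where
    x  = gen i ∙ gen j
    ys = progression x (gen i) k

  doubled-map : ∀ {f} → (∀ {x y} → x ≈ y → f x ≈ f y) → ∀ {xs} → Doubled xs → Doubled (map f xs)
  doubled-map {f} f-cong (ys , p) = map f ys ,
    subst (map f _ ≋_) (List.map-++ f ys ys) (≋-map f-cong p)

  -- The parity of the number of occurrences of t: a relation, as _≈_ is not decidable.
  data Parity (t : Carrier) : List Carrier → Bool → Set (c ⊔ ℓ) where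
    []   : Parity t [] false
    hit  : ∀ {x xs b} → t ≈ x → Parity t xs b → Parity t (x ∷ xs) (not b)
    miss : ∀ {x xs b} → ¬ t ≈ x → Parity t xs b → Parity t (x ∷ xs) b

  parity-total : ∀ t xs → ¬ ¬ ∃ (Parity t xs)
  parity-total t []       = pure (false , [])
  parity-total t (x ∷ xs) = do
    (b , p) ← parity-total t xs
    ¬¬-excluded-middle >>= λ where
      (yes t≈x) → pure (not b , hit t≈x p)
      (no t≉x)  → pure (b , miss t≉x p)

  parity-unique : ∀ {t xs b b′} → Parity t xs b → Parity t xs b′ → b ≡ b′
  parity-unique []          []          = refl
  parity-unique (hit _ p)   (hit _ q)   = cong not (parity-unique p q)
  parity-unique (hit e _)   (miss ¬e _) = contradiction e ¬e
  parity-unique (miss ¬e _) (hit e _)   = contradiction e ¬e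
  parity-unique (miss _ p)  (miss _ q)  = parity-unique p q

  parity-resp : ∀ {t xs ys b} → xs ≋ ys → Parity t xs b → Parity t ys b
  parity-resp []       []          = []
  parity-resp (e ∷ es) (hit h p)   = hit (trans h e) (parity-resp es p)
  parity-resp (e ∷ es) (miss h p)  = miss (λ h′ → h (trans h′ (sym e))) (parity-resp es p)

  not-xor : ∀ x y → not x xor y ≡ not (x xor y)
  not-xor false y = refl
  not-xor true  y = ≡.sym (not-involutive y)

  parity-++ : ∀ {t xs ys b b′} → Parity t xs b → Parity t ys b′ → Parity t (xs ++ ys) (b xor b′)
  parity-++ []                  q = q
  parity-++ (hit {b = b} e p)   q = subst (Parity _ _) (≡.sym (not-xor b _)) (hit e (parity-++ p q))
  parity-++ (miss ¬e p)         q = miss ¬e (parity-++ p q)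

  parity-doubled : ∀ {t xs} → Doubled xs → ¬ ¬ Parity t xs false
  parity-doubled {t} (ys , p) = do
    (b , q) ← parity-total t ys
    pure (parity-resp (Pointwise.symmetric sym p) (subst (Parity t _) (xor-same b) (parity-++ q q)))

  -- The relator contributes each reflection an even number of times. Having value 1, it conjugates
  -- trivially and leaves the reflections of the letters after it unchanged.
  parity-relator : ∀ {t} v w i j k → gpow W (gen i ∙ gen j) k ≈ ε →
                   ¬ ¬ ∃ λ b → Parity t (refls (v ++ (alt i j k ++ w))) b × Parity t (refls (v ++ w)) b
  parity-relator {t} v w i j k p = do
      (b₁ , q₁) ← parity-total t (refls v)
      q₂        ← parity-doubled {t} (doubled-map (conjW-cong v) (doubled-refls-alt i j k p))
      (b₃ , q₃) ← parity-total t (map (conjW v) (refls w))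
      pure (b₁ xor b₃ , parity-resp split (parity-++ q₁ (parity-++ q₂ q₃)) ,
            subst (λ xs → Parity t xs _) (≡.sym (refls-++ v w)) (parity-++ q₁ q₃))
    where
    u = alt i j k

    conjW-alt : ∀ {x y} → x ≈ y → x ≈ conjW u y
    conjW-alt {x} {y} x≈y = begin
      x                  ≈⟨ x≈y ⟩
      y                  ≈⟨ identityˡ y ⟨
      ε ∙ y              ≈⟨ ∙-congʳ u≈ε ⟨
      eval u ∙ y         ≈⟨ conjW-eval u y ⟨
      conjW u y ∙ eval u ≈⟨ ∙-congˡ u≈ε ⟩
      conjW u y ∙ ε      ≈⟨ identityʳ _ ⟩
      conjW u y          ∎
      where
      u≈ε : eval u ≈ ε
      u≈ε = trans (eval-alt i j k) p

    split : refls v ++ (map (conjW v) (refls u) ++ map (conjW v) (refls w)) ≋ refls (v ++ (u ++ w))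
    split = subst ((refls v ++ (map (conjW v) (refls u) ++ map (conjW v) (refls w))) ≋_)
      (≡.sym (≡.trans (refls-++ v (u ++ w)) (cong (λ xs → refls v ++ xs)
        (≡.trans (cong (map (conjW v)) (refls-++ u w)) (List.map-++ (conjW v) (refls u) _)))))
      (Pointwise.++⁺ (≋-refl {refls v}) (Pointwise.++⁺ (≋-refl {map (conjW v) (refls u)})
        (≋-map (conjW-cong v) (subst (_≋ map (conjW u) (refls w)) (List.map-id (refls w)) (≋-map conjW-alt (≋-refl {refls w}))))))

  parity-~ : ∀ {t v w} → v ~ w → ¬ ¬ ∃ λ b → Parity t (refls v) b × Parity t (refls w) b
  parity-~ (relator v w i j k p) = parity-relator v w i j k p
  parity-~ {t} (~-refl {v})      = parity-total t (refls v) >>= λ (b , p) → pure (b , p , p)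
  parity-~ (~-sym p)             = parity-~ p >>= λ (b , q , q′) → pure (b , q′ , q)
  parity-~ {t} (~-trans p p′)    = do
    (b , q , r)    ← parity-~ p
    (b′ , r′ , q′) ← parity-~ p′
    pure (b , q , subst (Parity _ _) (parity-unique r′ r) q′)

  -- Reduced words

  Distinct : List Carrier → Set _
  Distinct = AllPairs (λ x y → ¬ x ≈ y)

  DistinctRefls : Word → Set _
  DistinctRefls w = Distinct (refls w)

  record Minimal (w : Word) : Set ℓ where
    constructor minimal
    field shortest : ∀ w′ → eval w′ ≈ eval w → length w ≤ length w′
  open Minimal

  parity-none : ∀ {t xs} → All (λ x → ¬ t ≈ x) xs → Parity t xs false
  parity-none []       = []
  parity-none (h ∷ hs) = miss h (parity-none hs)

  parity-distinct : ∀ {t xs} → Distinct xs → Any (t ≈_) xs → Parity t xs true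
  parity-distinct (d ∷ _)  (here e)    = hit e (parity-none (All.map (λ d′ e′ → d′ (trans (sym e) e′)) d))
  parity-distinct (d ∷ ds) (there any) = miss (λ e → All.All¬⇒¬Any (All.map (λ d′ e′ → d′ (trans (sym e) e′)) d) any)
                                              (parity-distinct ds any)

  parity-true : ∀ {t xs b} → b ≡ true → Parity t xs b → Any (t ≈_) xs
  parity-true _      (hit e _)  = here e
  parity-true b≡true (miss _ p) = there (parity-true b≡true p)

  -- Without repetitions, occurring means occurring an odd number of times; an odd parity for `w`
  -- then forces an occurrence there.
  refls-⊆ : ∀ {t v w} → DistinctRefls v → eval v ≈ eval w → Any (t ≈_) (refls v) → ¬ ¬ Any (t ≈_) (refls w)
  refls-⊆ {v = v} {w} d v≈w any = do
    (b , p , q) ← parity-~ (presentation v w v≈w)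
    pure (parity-true (parity-unique p (parity-distinct d any)) q)

  members : (xs : List Carrier) → All (λ x → Any (x ≈_) xs) xs
  members []       = []
  members (x ∷ xs) = here ≈-refl ∷ All.map there (members xs)

  -- Both lists enumerate the inversion set of the common value, the reflections of odd parity.
  length-distinctRefls : ∀ v w → DistinctRefls v → DistinctRefls w → eval v ≈ eval w → length v ≡ length w
  length-distinctRefls v w dv dw v≈w = ≡.trans (≡.sym (length-refls v)) (≡.trans
    (length-match _≈_ (refls v) (refls w)
      (AllPairs.map (λ d _ p q → d (trans p (sym q))) dv)
      (AllPairs.map (λ d _ p q → d (trans (sym p) q)) dw)
      (All.map (refls-⊆ {v = v} {w} dv v≈w) (members (refls v)))
      (All.map (λ any → refls-⊆ {v = w} {v} dw (sym v≈w) any >>= λ any′ → pure (Any.map sym any′)) (members (refls w))))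
    (length-refls w))

  Deletion : ∀ {p} → (Fin n → Set p) → Word → Carrier → Set _
  Deletion P w x = ∃ λ w′ → length w′ < length w × All P w′ × eval w′ ≈ x ∙ eval w

  deletions : ∀ {p} {P : Fin n → Set p} {w} → All P w → All (Deletion P w) (refls w)
  deletions []                      = []
  deletions {P = P} {i ∷ w} (h ∷ hs) = (w , ℕ.≤-refl , hs , sym (gen-cancelˡ i (eval w))) ∷
    All.map⁺ (All.map (λ (w′ , l , hs′ , e) → i ∷ w′ , s≤s l , h ∷ hs′ , trans (∙-congˡ e) (sym (conj-gen i _ _)))
                      (deletions hs))

  conj-fixed : ∀ i x → gen i ≈ conj i x → x ≈ gen i
  conj-fixed i x e = conj-injective i (trans (sym e) (sym (trans (∙-congˡ (involution i)) (identityʳ _))))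

  -- If s collides with a reflection s r s from `v`, then r = s, so deleting a letter of `v` gives a
  -- shorter word for s · `eval v`, which is reduced in turn. That word is not a part of the input;
  -- the recursion runs on the length bound `k`.
  reduce : ∀ {p} {P : Fin n → Set p} k w → length w ≤ k → All P w →
           ¬ ¬ ∃ λ v → DistinctRefls v × All P v × eval v ≈ eval w × length v ≤ length w
  reduce k []      _ _ = pure ([] , [] , [] , ≈-refl , z≤n)
  reduce {P = P} (suc k) (i ∷ w) (s≤s l) (h ∷ hs) = do
    (v , dv , hv , v≈w , v≤w) ← reduce k w l hs
    ¬¬-none-or-any (gen i ≈_) (map (conj i) (refls v)) >>= λ where
      (inj₁ none) → pure (i ∷ v , none ∷ AllPairs.map⁺ (AllPairs.map (λ d e → d (conj-injective i e)) dv) ,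
                          h ∷ hv , ∙-congˡ v≈w , s≤s v≤w)
      (inj₂ any)  → case All.lookupAny (deletions hv) (Any.map⁻ any) of λ where
        ((v′ , v′<v , hv′ , v′≈) , e) → do
          (u , du , hu , u≈v′ , u≤v′) ← reduce k v′ (ℕ.≤-trans (ℕ.<⇒≤ v′<v) (ℕ.≤-trans v≤w l)) hv′
          pure (u , du , hu , trans u≈v′ (trans v′≈ (∙-cong (conj-fixed i _ e) v≈w)) ,
                ℕ.≤-trans u≤v′ (ℕ.≤-trans (ℕ.<⇒≤ v′<v) (ℕ.m≤n⇒m≤1+n v≤w)))

  all-letters : (w : Word) → All (λ _ → ⊤) w
  all-letters w = All.universal (λ _ → tt) w

  -- Any competitor reduces to a word with distinct reflections and the same value, and all such
  -- words are equally long.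
  distinctRefls⇒minimal : ∀ w → DistinctRefls w → Minimal w
  distinctRefls⇒minimal w dw = minimal λ w′ e → decidable-stable (_ ℕ.≤? _) do
    (v , dv , _ , v≈w′ , v≤w′) ← reduce (length w′) w′ ℕ.≤-refl (all-letters w′)
    pure (subst (_≤ length w′) (length-distinctRefls v w dv dw (trans v≈w′ e)) v≤w′)

  minimal-tail : ∀ {i w} → Minimal (i ∷ w) → Minimal w
  minimal-tail {i} min = minimal λ w′ e → ℕ.≤-pred (shortest min (i ∷ w′) (∙-congˡ e))

  -- If the first reflection recurred, deleting the matching letter of the tail would give a word
  -- for the whole value that is shorter even than the tail.
  minimal⇒distinctRefls : ∀ w → Minimal w → DistinctRefls w
  minimal⇒distinctRefls []      _   = []
  minimal⇒distinctRefls (i ∷ w) min =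
    All.map⁺ (All.map (λ { (w′ , w′<w , _ , e) e′ → ℕ.<⇒≱ (ℕ.<-trans w′<w (ℕ.n<1+n _))
                             (shortest min w′ (trans e (∙-congʳ (conj-fixed i _ e′)))) })
                      (deletions (all-letters w)))
    ∷ AllPairs.map⁺ (AllPairs.map (λ d e → d (conj-injective i e)) (minimal⇒distinctRefls w (minimal-tail min)))

  -- Competitors may use any letters, while the word found keeps to `P`: elements of W_I have
  -- reduced words in I.
  minimalWord : ∀ {p} {P : Fin n → Set p} {w} → All P w → ¬ ¬ ∃ λ v → Minimal v × All P v × eval v ≈ eval w
  minimalWord {w = w} hw = do
    (v , dv , hv , e , _) ← reduce (length w) w ℕ.≤-refl hw
    pure (v , distinctRefls⇒minimal v dv , hv , e)

  minimalWordFor : ∀ x → ¬ ¬ ∃ λ v → Minimal v × eval v ≈ x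
  minimalWordFor x = do
    (v , min , _ , e) ← minimalWord (all-letters (proj₁ (generates x)))
    pure (v , min , trans e (proj₂ (generates x)))

  minimal-length : ∀ {v w} → Minimal v → Minimal w → eval v ≈ eval w → length v ≡ length w
  minimal-length {v} {w} mv mw e = ℕ.≤-antisym (shortest mv w (sym e)) (shortest mw v e)

  minimal-resp : ∀ {v w} → Minimal v → eval v ≈ eval w → length v ≡ length w → Minimal w
  minimal-resp mv e l = minimal λ u e′ → subst (_≤ length u) l (shortest mv u (trans e′ (sym e)))

  minimal-reverse : ∀ {w} → Minimal w → Minimal (reverse w)
  minimal-reverse {w} min = minimal λ u e → subst₂ _≤_ (≡.sym (List.length-reverse w)) (List.length-reverse u)
      (shortest min (reverse u) (trans (eval-reverse u) (trans (⁻¹-cong (trans e (eval-reverse w))) (⁻¹-involutive _))))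
    where open ≡ using (subst₂)

  minimal⇒isLength : ∀ {w x} → Minimal w → eval w ≈ x → IsLength x (length w)
  minimal⇒isLength {w} min e = (w , refl , e) , λ u e′ → shortest min u (trans e′ (sym e))

  isLength-resp : ∀ {x y k} → x ≈ y → IsLength x k → IsLength y k
  isLength-resp e ((w , l , e′) , min) = (w , l , trans e′ e) , λ u e″ → min u (trans e″ (sym e))

  isLength-⁻¹ : ∀ {x k} → IsLength x k → IsLength (x ⁻¹) k
  isLength-⁻¹ ((w , l , e) , min) =
    (reverse w , ≡.trans (List.length-reverse w) l , trans (eval-reverse w) (⁻¹-cong e)) ,
    λ u e′ → subst (_ ≤_) (List.length-reverse u)
      (min (reverse u) (trans (eval-reverse u) (trans (⁻¹-cong e′) (⁻¹-involutive _))))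

  lengthExists : ∀ x → ¬ ¬ ∃ (IsLength x)
  lengthExists x = minimalWordFor x >>= λ (v , min , e) → pure (length v , minimal⇒isLength min e)

  reduced⇒minimal : ∀ {x w} → Reduced x w → Minimal w
  reduced⇒minimal (e , _ , min) = minimal λ u e′ → min u (trans e′ e)

  LenLe⇒length≤ : ∀ {x y v} w → LenLe x y → Minimal v → eval v ≈ x → eval w ≈ y → length v ≤ length w
  LenLe⇒length≤ {y = y} w le min ex ey = decidable-stable (_ ℕ.≤? _) do
    (k , isLen) ← lengthExists y
    pure (ℕ.≤-trans (le _ _ (minimal⇒isLength min ex) isLen) (proj₂ isLen w ey))

  minimal⇒LenLt : ∀ {i w} → Minimal (i ∷ w) → LenLt (eval w) (gen i ∙ eval w)
  minimal⇒LenLt {w = w} min a b (_ , ha) ((u , refl , e) , _) = ℕ.≤-trans (s≤s (ha w ≈-refl)) (shortest min u e)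

  LenLt-asym : ∀ {x y} → LenLt x y → LenLt y x → ⊥
  LenLt-asym {x} {y} p q = (do
    (a , ha) ← lengthExists x
    (b , hb) ← lengthExists y
    pure (ℕ.<-asym (p a b ha hb) (q b a hb ha))) λ ()

  LenLt-resp : ∀ {x x′ y y′} → x ≈ x′ → y ≈ y′ → LenLt x y → LenLt x′ y′
  LenLt-resp e f p a b ha hb = p a b (isLength-resp (sym e) ha) (isLength-resp (sym f) hb)

  LenLt-⁻¹ : ∀ {x y} → LenLt (x ⁻¹) (y ⁻¹) → LenLt x y
  LenLt-⁻¹ p a b ha hb = p a b (isLength-⁻¹ ha) (isLength-⁻¹ hb)

  isLength-unique : ∀ {x a b} → IsLength x a → IsLength x b → a ≡ b
  isLength-unique ((v , refl , e) , ha) ((w , refl , f) , hb) = ℕ.≤-antisym (ha w f) (hb v e)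

  LenLt-intro : ∀ {x y a b} → IsLength x a → IsLength y b → a < b → LenLt x y
  LenLt-intro ha hb a<b a′ b′ ha′ hb′
    rewrite isLength-unique ha′ ha | isLength-unique hb′ hb = a<b

  ascent-or-descent : ∀ x i → ¬ ¬ (LenLt x (x ∙ gen i) ⊎ LenLt (x ∙ gen i) x)
  ascent-or-descent x i = do
    (v , mv , v≈) ← minimalWordFor x
    (w , mw , w≈) ← minimalWordFor (x ∙ gen i)
    let hv = minimal⇒isLength mv v≈
        hw = minimal⇒isLength mw w≈
    case ℕ.<-cmp (length v) (length w) of λ where
      (tri< l _ _) → pure (inj₁ (LenLt-intro hv hw l))
      (tri> _ _ l) → pure (inj₂ (LenLt-intro hw hv l))
      (tri≈ _ l _) → contradiction (odd v w v≈ w≈ l) λ ()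
    where
    open import Relation.Binary.Definitions using (tri<; tri≈; tri>)
    odd : ∀ v w → eval v ≈ x → eval w ≈ x ∙ gen i → length v ≡ length w → ⊥
    odd v w v≈ w≈ l = not-¬ refl (≡.sym (≡.trans (≡.sym (isOdd-snoc v)) (≡.trans
      (isOdd-~ (presentation (v ++ [ i ]) w (trans (eval-++ v [ i ]) (trans (∙-cong v≈ (identityʳ _)) (sym w≈)))))
      (cong isOdd (≡.sym l)))))
      where
      isOdd-snoc : ∀ u → isOdd (length (u ++ [ i ])) ≡ not (isOdd (length u))
      isOdd-snoc []      = refl
      isOdd-snoc (_ ∷ u) = cong not (isOdd-snoc u)

  -- Parabolic subgroups and their cosets

  inPar-resp : ∀ {I x y} → x ≈ y → InPar I x → InPar I y
  inPar-resp e (w , hw , e′) = w , hw , trans e′ e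

  inPar-ε : ∀ {I} → InPar I ε
  inPar-ε = [] , [] , ≈-refl

  inPar-gen : ∀ {I i} → i ∈ I → InPar I (gen i)
  inPar-gen {i = i} h = [ i ] , h ∷ [] , identityʳ _

  inPar-∙ : ∀ {I x y} → InPar I x → InPar I y → InPar I (x ∙ y)
  inPar-∙ (v , hv , e) (w , hw , f) = v ++ w , All.++⁺ hv hw , trans (eval-++ v w) (∙-cong e f)

  inPar-⁻¹ : ∀ {I x} → InPar I x → InPar I (x ⁻¹)
  inPar-⁻¹ (w , hw , e) = reverse w , All-resp-↭ (↭-sym (↭-reverse w)) hw , trans (eval-reverse w) (⁻¹-cong e)

  inPar-eval : ∀ {I w} → All (_∈ I) w → InPar I (eval w)
  inPar-eval {w = w} hw = w , hw , ≈-refl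

  -- The cosets m v W_J in W_K v W_J

  module _ {K J : Subset n} {v : Carrier} where

    conj-deletion : ∀ {k x y k′} → x ≈ conjW k y → eval k′ ≈ x ∙ eval k → eval k′ ≈ eval k ∙ y
    conj-deletion {k} {y = y} e f = trans f (trans (∙-congʳ e) (conjW-eval k y))

    -- If the concatenation k v b were not reduced, two of its reflections would
    -- coincide and the corresponding letters, lying in different factors, could
    -- be deleted simultaneously; this contradicts minimality of v or of m.
    minimal-parabolic : ∀ {m vw k b} → InR K J v → Reduced v vw → InM K J v m →
                        Minimal k → All (_∈ K) k → eval k ≈ m → Minimal b → All (_∈ J) b →
                        Minimal (k ++ (vw ++ b))
    minimal-parabolic {m} {vw} {k} {b} hv rv (_ , hm) mk hk k≈m mb hb =
      distinctRefls⇒minimal (k ++ (vw ++ b)) (subst Distinct (≡.sym (refls-++ k (vw ++ b)))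
        (AllPairs.++⁺ (minimal⇒distinctRefls k mk)
          (AllPairs.map⁺ (AllPairs.map (λ d e → d (conjW-injective k e)) distinct-vb))
          (All.map (λ dx → All.map⁺ (subst (All _) (≡.sym (refls-++ vw b))
             (All.++⁺ (All.map (clash-kv dx) (deletions (all-letters vw)))
                      (All.map⁺ (All.map (clash-kb dx) (deletions hb))))))
           (deletions hk))))
      where
      mv : Minimal vw
      mv = reduced⇒minimal rv

      vw≈v : eval vw ≈ v
      vw≈v = proj₁ rv

      inK : ∀ {x y k′} → All (_∈ K) k′ → x ≈ conjW k y → eval k′ ≈ x ∙ eval k → InPar K y
      inK {y = y} {k′} hk′ e f = inPar-resp
        (trans (∙-congˡ (conj-deletion {k} {k′ = k′} e f)) (\\-leftDividesʳ (eval k) y))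
        (inPar-∙ (inPar-⁻¹ (inPar-eval hk)) (inPar-eval hk′))

      inJ : ∀ {y b′} → All (_∈ J) b′ → eval b′ ≈ y ∙ eval b → InPar J y
      inJ {y} {b′} hb′ f = inPar-resp (trans (∙-congʳ f) (//-rightDividesʳ (eval b) y))
        (inPar-∙ (inPar-eval hb′) (inPar-⁻¹ (inPar-eval hb)))

      clash-kv : ∀ {x y} → Deletion (_∈ K) k x → Deletion (λ _ → ⊤) vw y → ¬ x ≈ conjW k y
      clash-kv {y = y} (k′ , _ , hk′ , ek) (v′ , v′<v , _ , ev) e = ℕ.<⇒≱ v′<v
        (LenLe⇒length≤ v′ (hv y ε (inK hk′ e ek) inPar-ε) mv vw≈v
          (trans ev (trans (∙-congˡ vw≈v) (sym (identityʳ _)))))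

      clash-vb : ∀ {x y} → Deletion (λ _ → ⊤) vw x → Deletion (_∈ J) b y → ¬ x ≈ conjW vw y
      clash-vb {y = y} (v′ , v′<v , _ , ev) (b′ , _ , hb′ , eb) e = ℕ.<⇒≱ v′<v
        (LenLe⇒length≤ v′ (hv ε y inPar-ε (inJ hb′ eb)) mv vw≈v
          (trans (conj-deletion {vw} {k′ = v′} e ev) (∙-congʳ (trans vw≈v (sym (identityˡ v))))))

      -- Put z = v y v⁻¹. One deletion gives z ∈ W_K, the other v⁻¹ z v = y ∈ W_J, and `k′` is a
      -- word for m z shorter than m.
      clash-kb : ∀ {x y} → Deletion (_∈ K) k x → Deletion (_∈ J) b y → ¬ x ≈ conjW k (conjW vw y)
      clash-kb {y = y} (k′ , k′<k , hk′ , ek) (b′ , _ , hb′ , eb) e = ℕ.<⇒≱ k′<k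
        (LenLe⇒length≤ k′ (hm z (inK hk′ e ek) (inPar-resp y≈ (inJ hb′ eb))) mk k≈m
          (trans (conj-deletion {k} {k′ = k′} e ek) (∙-congʳ k≈m)))
        where
        z = conjW vw y
        y≈ : y ≈ (v ⁻¹ ∙ z) ∙ v
        y≈ = sym (begin
          (v ⁻¹ ∙ z) ∙ v       ≈⟨ assoc _ _ _ ⟩
          v ⁻¹ ∙ (z ∙ v)       ≈⟨ ∙-congˡ (∙-congˡ vw≈v) ⟨
          v ⁻¹ ∙ (z ∙ eval vw) ≈⟨ ∙-congˡ (conjW-eval vw y) ⟩
          v ⁻¹ ∙ (eval vw ∙ y) ≈⟨ ∙-congˡ (∙-congʳ vw≈v) ⟩
          v ⁻¹ ∙ (v ∙ y)       ≈⟨ \\-leftDividesʳ v y ⟩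
          y                    ∎)

      distinct-vb : DistinctRefls (vw ++ b)
      distinct-vb = subst Distinct (≡.sym (refls-++ vw b)) (AllPairs.++⁺ (minimal⇒distinctRefls vw mv)
        (AllPairs.map⁺ (AllPairs.map (λ d e → d (conjW-injective vw e)) (minimal⇒distinctRefls b mb)))
        (All.map (λ dx → All.map⁺ (All.map (clash-vb dx) (deletions hb))) (deletions (all-letters vw))))

    -- The letters of `mw` are not known to lie in K. A minimal word `k` for m with letters in K
    -- takes its place; minimality of the concatenation depends only on value and length.
    minimal-coset : ∀ {m mw vw b} → InR K J v → Reduced v vw → InM K J v m → Reduced m mw →
                    Minimal b → All (_∈ J) b → Minimal ((mw ++ vw) ++ b)
    minimal-coset {mw = mw} {vw} {b} hv rv hm rm mb hb = minimal λ u e → decidable-stable (_ ℕ.≤? _) do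
      let k₀ , hk₀ , k₀≈m = proj₁ hm
      (k , mk , hk , k≈k₀) ← minimalWord hk₀
      let k≈m = trans k≈k₀ k₀≈m
          k≈mw = trans k≈m (sym (proj₁ rm))
          same-value = trans (eval-++ k (vw ++ b)) (trans (∙-congʳ k≈mw) (sym (eval-++ mw (vw ++ b))))
          same-length = ≡.trans (List.length-++ k) (≡.trans
            (cong (_+ length (vw ++ b)) (minimal-length mk (reduced⇒minimal {w = mw} rm) k≈mw)) (≡.sym (List.length-++ mw)))
          min = minimal-resp (minimal-parabolic hv rv hm mk hk k≈m mb hb) same-value same-length
      pure (shortest (subst Minimal (≡.sym (List.++-assoc mw vw b)) min) u e)

    -- The group W_K ∩ vW_Jv⁻¹, which stabilizes the coset vW_J in W_K.
    Stabilizer : Carrier → Set _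
    Stabilizer x = InPar K x × InPar J ((v ⁻¹ ∙ x) ∙ v)

    stabilizer-ε : Stabilizer ε
    stabilizer-ε = inPar-ε , inPar-resp (sym (trans (∙-congʳ (identityʳ _)) (inverseˡ v))) inPar-ε

    stabilizer-// : ∀ {x y} → Stabilizer x → Stabilizer y → Stabilizer (x ∙ y ⁻¹)
    stabilizer-// {x} {y} (px , qx) (py , qy) = inPar-∙ px (inPar-⁻¹ py) , inPar-resp (begin
      ((v ⁻¹ ∙ x) ∙ v) ∙ ((v ⁻¹ ∙ y) ∙ v) ⁻¹  ≈⟨ ∙-congˡ (⁻¹-anti-homo-∙ _ _) ⟩
      ((v ⁻¹ ∙ x) ∙ v) ∙ (v ⁻¹ ∙ (v ⁻¹ ∙ y) ⁻¹) ≈⟨ cancelᶜ (inverseʳ v) _ _ ⟩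
      (v ⁻¹ ∙ x) ∙ (v ⁻¹ ∙ y) ⁻¹              ≈⟨ ∙-congˡ (trans (⁻¹-anti-homo-∙ _ _) (∙-congˡ (⁻¹-involutive v))) ⟩
      (v ⁻¹ ∙ x) ∙ (y ⁻¹ ∙ v)                 ≈⟨ assoc _ _ _ ⟨
      ((v ⁻¹ ∙ x) ∙ y ⁻¹) ∙ v                 ≈⟨ ∙-congʳ (assoc _ _ _) ⟩
      (v ⁻¹ ∙ (x ∙ y ⁻¹)) ∙ v                 ∎) (inPar-∙ qx (inPar-⁻¹ qy))

    -- Descent on the length, bounded by `k`. If there were no representative, `a` itself would be
    -- minimal: a shorter `a ∙ x` has a representative by induction, and it serves for `a` too.
    minimalInCoset : ∀ k {a l} → InPar K a → IsLength a l → l ≤ k →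
                     ¬ ¬ ∃ λ m → InM K J v m × ∃ λ x → Stabilizer x × a ≈ m ∙ x
    minimalInCoset k {a} {l} pa la l≤k none =
      none (a , (pa , λ x px qx p q hp hq → decidable-stable (p ℕ.≤? q) λ p≰q →
        descend k x (px , qx) hq (ℕ.<-≤-trans (ℕ.≰⇒> p≰q) (subst (_≤ k) (isLength-unique la hp) l≤k))) ,
        ε , stabilizer-ε , sym (identityʳ a))
      where
      descend : ∀ k {q} x → Stabilizer x → IsLength (a ∙ x) q → q < k → ⊥
      descend (suc k) x sx hq (s≤s q≤k) =
        minimalInCoset k (inPar-∙ pa (proj₁ sx)) hq q≤k λ (m , hm , y , sy , e) →
          none (m , hm , y ∙ x ⁻¹ , stabilizer-// sy sx ,
                trans (sym (//-rightDividesʳ x a)) (trans (∙-congʳ e) (assoc _ _ _)))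

    -- The stabilizing factor x of a = m x passes through v as x v = v b with b = v⁻¹ x v.
    cosetDecomposition : ∀ {a} → InPar K a → ¬ ¬ ∃₂ λ m b → InM K J v m × InPar J b × a ∙ v ≈ (m ∙ v) ∙ b
    cosetDecomposition {a} pa = do
      (l , hl)                        ← lengthExists a
      (m , hm , x , (_ , qx) , a≈mx) ← minimalInCoset l pa hl ℕ.≤-refl
      pure (m , (v ⁻¹ ∙ x) ∙ v , hm , qx , (begin
        a ∙ v                          ≈⟨ ∙-congʳ a≈mx ⟩
        (m ∙ x) ∙ v                    ≈⟨ assoc _ _ _ ⟩
        m ∙ (x ∙ v)                    ≈⟨ cancelᶜ (inverseʳ v) m (x ∙ v) ⟨
        (m ∙ v) ∙ (v ⁻¹ ∙ (x ∙ v))     ≈⟨ ∙-congˡ (assoc _ _ _) ⟨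
        (m ∙ v) ∙ ((v ⁻¹ ∙ x) ∙ v)     ∎))

  -- Galleries and residues

  module Galleries {b : Level} {q : Fin n → ℕ} (X : Building q b) where
    open Building X
    open Simp X

    δ-refl : ∀ x → δ x x ≈ ε
    δ-refl x = proj₂ (wd1 x x) refl

    δ-ε : ∀ {x y} → δ x y ≈ ε → x ≡ y
    δ-ε {x} {y} = proj₁ (wd1 x y)

    δ-step : ∀ {x x′ i} y → δ x′ x ≈ gen i → (δ x′ y ≈ gen i ∙ δ x y) ⊎ (δ x′ y ≈ δ x y)
    δ-step {x} {x′} {i} y h = proj₁ (wd2 x y x′ i h)

    adjacent-sym : ∀ {x x′ i} → δ x′ x ≈ gen i → δ x x′ ≈ gen i
    adjacent-sym {x} {x′} {i} h with δ-step x′ h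
    ... | inj₁ e = gen-injective i (trans (trans (sym e) (δ-refl x′)) (sym (involution i)))
    ... | inj₂ e with refl ← δ-ε (trans (sym e) (δ-refl x′)) = contradiction (trans (sym h) (δ-refl x′)) (nonTrivial i)

    Gallery : Ch → Word → Ch → Set _
    Gallery x []      y = Lift ℓ (x ≡ y)
    Gallery x (i ∷ w) y = ∃ λ x′ → δ x′ x ≈ gen i × Gallery x′ w y

    gallery-++ : ∀ {x y z} v w → Gallery x v y → Gallery y w z → Gallery x (v ++ w) z
    gallery-++ []      w (lift refl)  h = h
    gallery-++ (i ∷ v) w (x′ , a , g) h = x′ , a , gallery-++ v w g h

    gallery-reverse : ∀ {x y} w → Gallery x w y → Gallery y (reverse w) x
    gallery-reverse []      (lift refl)      = lift refl
    gallery-reverse {x} {y} (i ∷ w) (x′ , a , g) = subst (λ v → Gallery y v x) (≡.sym (List.unfold-reverse i w))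
      (gallery-++ (reverse w) [ i ] (gallery-reverse w g) (x , adjacent-sym a , lift refl))

    -- By `wd3` some neighbour changes the distance to `y` by exactly the factor s, whether that is
    -- an ascent or a descent. So every word can be followed, reduced or not.
    walk : ∀ {x y g} w → δ x y ≈ eval w ∙ g → ∃ λ z → Gallery x w z × δ z y ≈ g
    walk {x} []      e = x , lift refl , trans e (identityˡ _)
    walk {x} {y} (i ∷ w) e with wd3 x y i
    ... | x′ , a , e′ with walk w (trans e′ (trans (∙-congˡ (trans e (assoc _ _ _))) (gen-cancelˡ i _)))
    ...   | z , g , f = z , (x′ , a , g) , f

    δ⇒gallery : ∀ {x y} w → δ x y ≈ eval w → Gallery x w y
    δ⇒gallery w e with walk w (trans e (sym (identityʳ _)))
    ... | z , g , f with refl ← δ-ε f = g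

    -- Read from its end, a reduced word lengthens with every letter, and in that case `wd2` allows
    -- only multiplication by s.
    gallery⇒δ : ∀ {x y w} → Minimal w → Gallery x w y → δ x y ≈ eval w
    gallery⇒δ {x} {w = []}    _   (lift refl) = δ-refl x
    gallery⇒δ {x} {y} {i ∷ w} min (x′ , a , g) = trans
        (proj₂ (wd2 x′ y x i (adjacent-sym a))
          (LenLt-resp (sym δx′y) (∙-congˡ (sym δx′y)) (minimal⇒LenLt min)))
        (∙-congˡ δx′y)
      where
      δx′y : δ x′ y ≈ eval w
      δx′y = gallery⇒δ (minimal-tail min) g

    δ-++ : ∀ {x y z} v w → Minimal (v ++ w) → δ x y ≈ eval v → δ y z ≈ eval w → δ x z ≈ eval (v ++ w)
    δ-++ v w min e f = gallery⇒δ min (gallery-++ v w (δ⇒gallery v e) (δ⇒gallery w f))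

    -- The axioms move only the first argument of δ; the second is reached by reversing a reduced
    -- gallery, and reduced words exist only up to double negation.
    δ-inverse : ∀ x y → ¬ ¬ δ y x ≈ δ x y ⁻¹
    δ-inverse x y = do
      (w , min , e) ← minimalWordFor (δ x y)
      pure (trans (gallery⇒δ (minimal-reverse min) (gallery-reverse w (δ⇒gallery w (sym e))))
                  (trans (eval-reverse w) (⁻¹-cong e)))

    module _ {I : Subset n} where

      -- By `wd2` each step either multiplies by its letter or changes nothing; `a` collects the
      -- letters that act.
      gallery-shift : ∀ {x x′ w} y → All (_∈ I) w → Gallery x w x′ → ∃ λ a → InPar I a × δ x y ≈ a ∙ δ x′ y
      gallery-shift y [] (lift refl) = ε , inPar-ε , sym (identityˡ _)
      gallery-shift {w = i ∷ w} y (h ∷ hs) (z , adj , g) with gallery-shift y hs g | δ-step y (adjacent-sym adj)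
      ... | a , pa , e | inj₁ f = gen i ∙ a , inPar-∙ (inPar-gen h) pa , trans f (trans (∙-congˡ e) (sym (assoc _ _ _)))
      ... | a , pa , e | inj₂ f = a , pa , trans f e

      gallery⇒same : ∀ {x y w} → All (_∈ I) w → Gallery x w y → SameSimp I x y
      gallery⇒same {y = y} hw g with gallery-shift y hw g
      ... | a , pa , e = inPar-resp (sym (trans e (trans (∙-congˡ (δ-refl y)) (identityʳ a)))) pa

      same-shift : ∀ {x x′} y → SameSimp I x x′ → ∃ λ a → InPar I a × δ x y ≈ a ∙ δ x′ y
      same-shift y (w , hw , e) = gallery-shift y hw (δ⇒gallery w (sym e))

      same-refl : ∀ x → SameSimp I x x
      same-refl x = inPar-resp (sym (δ-refl x)) inPar-ε

      same-sym : ∀ {x y} → SameSimp I x y → SameSimp I y x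
      same-sym {x} {y} (w , hw , e) =
        gallery⇒same (All-resp-↭ (↭-sym (↭-reverse w)) hw) (gallery-reverse w (δ⇒gallery w (sym e)))

      same-trans : ∀ {x y z} → SameSimp I x y → SameSimp I y z → SameSimp I x z
      same-trans {z = z} p p′ with same-shift z p
      ... | a , pa , e = inPar-resp (sym e) (inPar-∙ pa p′)

      same-walk : ∀ {x y a g} → InPar I a → δ x y ≈ a ∙ g → ∃ λ z → SameSimp I x z × δ z y ≈ g
      same-walk (w , hw , e) f with walk w (trans f (∙-congʳ (sym e)))
      ... | z , g , f′ = z , gallery⇒same hw g , f′

    -- Changing the chamber of A costs a left factor in W_I, changing that of D a right factor in
    -- W_J. The latter is found on the left of `δ z x` and therefore enters inverted.
    distIs⇒inDouble : ∀ {I J A x d z u} → SameSimp I A x → SameSimp J d z → DistIs I J A d u →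
                      ¬ ¬ InDouble I J u (δ z x ⁻¹)
    distIs⇒inDouble {I} {J} {x = x} {z = z} {u} Ax dz (x′ , d′ , Ax′ , dd′ , e) = do
      inv ← δ-inverse x d′
      pure (case same-shift {I} d′ (same-trans {I} (same-sym {I} Ax) Ax′) of λ (a , pa , ea) →
            case same-shift {J} x (same-trans {J} (same-sym {J} dz) dd′) of λ (b , pb , eb) →
            a , b ⁻¹ , pa , inPar-⁻¹ {J} pb , (begin
              δ z x ⁻¹               ≈⟨ ⁻¹-cong eb ⟩
              (b ∙ δ d′ x) ⁻¹        ≈⟨ ⁻¹-anti-homo-∙ _ _ ⟩
              δ d′ x ⁻¹ ∙ b ⁻¹       ≈⟨ ∙-congʳ (⁻¹-cong inv) ⟩
              (δ x d′ ⁻¹) ⁻¹ ∙ b ⁻¹  ≈⟨ ∙-congʳ (⁻¹-involutive _) ⟩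
              δ x d′ ∙ b ⁻¹          ≈⟨ ∙-congʳ (trans ea (∙-congˡ e)) ⟩
              (a ∙ u) ∙ b ⁻¹         ∎))

    inDouble⇒distIs : ∀ {I J A x z u} → SameSimp I A x → InDouble I J u (δ z x ⁻¹) → ¬ ¬ DistIs I J A z u
    inDouble⇒distIs {I} {J} {x = x} {z} {u} Ax (a , b , pa , pb , e) =
      case same-walk {J} (inPar-⁻¹ {J} pb) from-z of λ (z′ , zz′ , ez) → do
        inv ← δ-inverse z′ x
        pure (case same-walk {I} pa (trans inv (trans (⁻¹-cong ez) (⁻¹-involutive _))) of λ (x′ , xx′ , ex) →
              x′ , z′ , same-trans {I} Ax xx′ , zz′ , ex)
      where
      from-z : δ z x ≈ b ⁻¹ ∙ (a ∙ u) ⁻¹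
      from-z = trans (sym (⁻¹-involutive _)) (trans (⁻¹-cong e) (⁻¹-anti-homo-∙ _ _))

    -- The chamber of a J-simplex nearest to a given chamber

    module Representatives {K J : Subset n} {v : Carrier} (vw : Word) (v∈R : InR K J v) (v-reduced : Reduced v vw) where

      record IsRep (p : Carrier × Word) : Set (c ⊔ ℓ) where
        constructor rep
        field
          inM     : InM K J v (proj₁ p)
          reduced : Reduced (proj₁ p) (proj₂ p)
      open IsRep

      eval-rep : ∀ {p} → IsRep p → eval (proj₂ p ++ vw) ≈ proj₁ p ∙ v
      eval-rep {m , mw} (rep _ m-reduced) = trans (eval-++ mw vw) (∙-cong (proj₁ m-reduced) (proj₁ v-reduced))

      minimal-rep : ∀ {p} → IsRep p → Minimal (proj₂ p ++ vw)
      minimal-rep {m , mw} (rep m∈M m-reduced) = subst Minimal (List.++-identityʳ (mw ++ vw))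
        (minimal-coset {mw = mw} {vw} v∈R v-reduced m∈M m-reduced (minimal λ _ _ → z≤n) [])

      rep-distIs : ∀ {p B y z} → IsRep p → SameSimp K B y → δ y z ≈ eval (proj₂ p ++ vw) → DistIs K J B z v
      rep-distIs {z = z} h By e with same-walk (proj₁ (inM h)) (trans e (eval-rep h))
      ... | x , yx , f = x , z , same-trans By yx , same-refl z , f

      -- The distance from `y` to `d′` lies in W_K v, so it is m v b with b ∈ W_J. Walking 𝐦𝐯 from
      -- `y` ends at a chamber at distance b from `d′`, hence in the same simplex.
      rep-exists : ∀ {ms B y d} → MReps K J v ms → SameSimp K B y → DistIs K J B d v →
                   ¬ ¬ Any (λ p → ∃ λ z → SameSimp J d z × δ y z ≈ eval (proj₂ p ++ vw)) ms
      rep-exists {ms} {B} {y} {d} (reps , _ , complete) By (x , d′ , Bx , dd′ , e) =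
        case same-shift {K} d′ (same-trans {K} (same-sym {K} By) Bx) of λ (a , pa , ea) → do
          (m , b , m∈M , pb , f) ← cosetDecomposition {K} {J} pa
          pure (Any.map (λ {p} (p≈m , h) → through {p} p≈m h pb (trans ea (trans (∙-congˡ e) f)))
                        (any×all (complete m m∈M) (All.map (λ {p} (h , h′) → rep {p} h h′) reps)))
        where
        through : ∀ {p m b} → proj₁ p ≈ m → IsRep p → InPar J b → δ y d′ ≈ (m ∙ v) ∙ b →
                  ∃ λ z → SameSimp J d z × δ y z ≈ eval (proj₂ p ++ vw)
        through {p} p≈m h pb e =
          case walk (proj₂ p ++ vw) (trans e (∙-congʳ (trans (∙-congʳ (sym p≈m)) (sym (eval-rep h))))) of λ (z , g , ez) →
          z , same-trans {J} dd′ (same-sym {J} (inPar-resp {J} (sym ez) pb)) , gallery⇒δ (minimal-rep h) g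

      -- The word for m v followed by a reduced J-word from `z` to `z′` is still reduced, so its
      -- length is that of the distance from `y` to `z′`.
      rep-farther : ∀ {p p′ y z z′} → IsRep p → IsRep p′ → SameSimp J z z′ →
                    δ y z ≈ eval (proj₂ p ++ vw) → δ y z′ ≈ eval (proj₂ p′ ++ vw) →
                    ¬ ¬ ∃ λ w → eval w ≈ δ z z′ × length (proj₂ p′ ++ vw) ≡ length (proj₂ p ++ vw) + length w
      rep-farther {p} {p′} {y} h h′ (w₀ , hw₀ , e₀) e e′ =
        minimalWord hw₀ >>= λ (w , min , hw , w≈w₀) →
        pure (w , trans w≈w₀ e₀ , lengths w min hw (trans (sym e₀) (sym w≈w₀)))
        where
        lengths : ∀ w → Minimal w → All (_∈ J) w → _ ≈ eval w →
                  length (proj₂ p′ ++ vw) ≡ length (proj₂ p ++ vw) + length w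
        lengths w min hw f = ≡.trans
          (minimal-length (minimal-rep h′) min′ (trans (sym e′) (δ-++ (proj₂ p ++ vw) w min′ e f)))
          (List.length-++ (proj₂ p ++ vw))
          where
          min′ : Minimal ((proj₂ p ++ vw) ++ w)
          min′ = minimal-coset {mw = proj₂ p} {vw} v∈R v-reduced (inM h) (reduced h) min hw

      -- `rep-farther` in both directions makes each of two lengths the other plus something, so the
      -- distance from `z` to `z′` has length 0.
      rep-unique : ∀ {p p′ y z z′} → IsRep p → IsRep p′ → SameSimp J z z′ →
                   δ y z ≈ eval (proj₂ p ++ vw) → δ y z′ ≈ eval (proj₂ p′ ++ vw) → ¬ ¬ z ≡ z′
      rep-unique h h′ zz′ e e′ =
        rep-farther h h′ zz′ e e′ >>= λ (w , f , l) →
        rep-farther h′ h (same-sym {J} zz′) e′ e >>= λ (w′ , _ , l′) →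
        pure (δ-ε (trans (sym f) (eval-empty w (lengths-zero l l′))))
        where
        eval-empty : ∀ w → length w ≡ 0 → eval w ≈ ε
        eval-empty [] _ = ≈-refl

        lengths-zero : ∀ {i j k l} → i ≡ j + k → j ≡ i + l → k ≡ 0
        lengths-zero {i} {j} {k} {l} i≡ j≡ = ℕ.m+n≡0⇒m≡0 k (ℕ.+-cancelˡ-≡ j _ _ (≡.trans (≡.sym (ℕ.+-assoc j k l))
          (≡.trans (cong (_+ l) (≡.sym i≡)) (≡.trans (≡.sym j≡) (≡.sym (ℕ.+-identityʳ j))))))

  -- Counting galleries by the pregalleries of their distances

  module Counting {b p : Level} {q : Fin n → ℕ} (X : Building q b) (x₀ : Building.Ch X)
                  (P : Carrier → Set p) (P-resp : ∀ {x y} → x ≈ y → P x → P y) where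
    open Building X
    open Galleries X
    open Preg q

    -- The Weyl distance from x₀ to y, except that δ x₀ y ≈ (δ y x₀)⁻¹ is only
    -- available up to double negation.
    dist : Ch → Carrier
    dist y = δ y x₀ ⁻¹

    -- At a descent this is the one chamber of the panel nearer to x₀; at an ascent it is merely one
    -- of the q_s farther ones.
    toward : Ch → Fin n → Ch
    toward y i = proj₁ (wd3 y x₀ i)

    -- The panel of q_s + 1 chambers with `y` left out and `toward` singled out. The form of `size`
    -- makes q_s - 1 the length of a list.
    record Panel (y : Ch) (i : Fin n) : Set (c ⊔ ℓ ⊔ b) where
      field
        others   : List Ch
        size     : suc (length others) ≡ q i
        unique   : Unique (toward y i ∷ others)
        adjacent : All (λ z → δ z y ≈ gen i) (toward y i ∷ others)
        complete : ∀ {z} → δ z y ≈ gen i → z ∈ₗ toward y i ∷ others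

    adjacent⇒≢ : ∀ {y z i} → δ z y ≈ gen i → ¬ y ≡ z
    adjacent⇒≢ {y} {i = i} h refl = nonTrivial i (trans (sym h) (δ-refl y))

    panel : ∀ y i → Panel y i
    panel y i =
      case regular y i of λ (zs , zs-unique , zs-length , zs-members) →
      case pick (proj₂ (zs-members y) (inj₁ (δ-refl y))) of λ where
        (_ , ys , refl , zs↭) →
          case Any-resp-↭ zs↭ (proj₂ (zs-members g) (inj₂ (adjacent-sym g-adjacent))) of λ where
            (here g≡y)  → contradiction (≡.sym g≡y) (adjacent⇒≢ g-adjacent)
            (there g∈ys) → case pick g∈ys of λ where
              (_ , os , refl , ys↭) → split zs-unique zs-length zs-members (_↭_.trans zs↭ (prep y ys↭))
      where
      ≢-sym : ∀ {x z : Ch} → ¬ x ≡ z → ¬ z ≡ x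
      ≢-sym h e = h (≡.sym e)

      g = toward y i
      g-adjacent : δ g y ≈ gen i
      g-adjacent = proj₁ (proj₂ (wd3 y x₀ i))

      split : ∀ {zs os} → Unique zs → length zs ≡ suc (q i) →
              (∀ z → (z ∈ₗ zs → δ y z ≈ ε ⊎ δ y z ≈ gen i) × (δ y z ≈ ε ⊎ δ y z ≈ gen i → z ∈ₗ zs)) →
              zs ↭ y ∷ g ∷ os → Panel y i
      split {os = os} zs-unique zs-length zs-members perm = case AllPairs-resp-↭ ≢-sym perm zs-unique of λ where
        (y∉ ∷ os-unique) → record
          { others   = os
          ; size     = ℕ.suc-injective (≡.trans (≡.sym (↭-length perm)) zs-length)
          ; unique   = os-unique
          ; adjacent = All.zipWith (λ (y≢z , h) → case h of λ where
              (inj₁ e) → contradiction (δ-ε e) y≢z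
              (inj₂ e) → adjacent-sym e)
            (y∉ , All.tail (All-resp-↭ perm (All.tabulate λ {z} → proj₁ (zs-members z))))
          ; complete = λ {z} h → case Any-resp-↭ perm (proj₂ (zs-members z) (inj₂ (adjacent-sym h))) of λ where
              (here z≡y)  → contradiction (≡.sym z≡y) (adjacent⇒≢ h)
              (there any) → any
          }

    others : Ch → Fin n → List Ch
    others y i = Panel.others (panel y i)

    panel-mates : ∀ {y y′ y″ i} → δ y′ y ≈ gen i → δ y″ y ≈ gen i → ¬ y′ ≡ y″ → δ y′ y″ ≈ gen i
    panel-mates {y″ = y″} {i} h h′ y′≢y″ with δ-step y″ h
    ... | inj₁ e = contradiction (δ-ε (trans e (trans (∙-congˡ (adjacent-sym h′)) (involution i)))) y′≢y″
    ... | inj₂ e = trans e (adjacent-sym h′)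

    dist-step : ∀ {x y i} → x ≈ gen i ∙ y → x ⁻¹ ≈ y ⁻¹ ∙ gen i
    dist-step {x} {y} {i} e = trans (⁻¹-cong e)
      (trans (⁻¹-anti-homo-∙ _ _) (∙-congˡ (sym (inverseˡ-unique _ _ (involution i)))))

    dist-ascent : ∀ {w y z i} → LenLt w (w ∙ gen i) → dist y ≈ w → δ z y ≈ gen i → dist z ≈ w ∙ gen i
    dist-ascent {w} {y} {z} {i} lt e h = trans (dist-step (proj₂ (wd2 y x₀ z i h)
      (LenLt-⁻¹ (LenLt-resp (sym e) (trans (∙-congʳ (sym e)) (sym (dist-step ≈-refl))) lt)))) (∙-congʳ e)

    dist-toward : ∀ {w y i} → dist y ≈ w → dist (toward y i) ≈ w ∙ gen i
    dist-toward {w} {y} {i} e = trans (dist-step (proj₂ (proj₂ (wd3 y x₀ i)))) (∙-congʳ e)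

    -- Seen from `toward y i`, every other chamber of the panel is an ascent, which leads back to (w
    -- s) s = w.
    dist-other : ∀ {w y z i} → LenLt (w ∙ gen i) w → dist y ≈ w → δ z y ≈ gen i → ¬ toward y i ≡ z → dist z ≈ w
    dist-other {w} {y} {z} {i} lt e h t≢z = trans
        (dist-ascent {w ∙ gen i} (LenLt-resp ≈-refl (sym back) lt) (dist-toward e)
          (panel-mates h (proj₁ (proj₂ (wd3 y x₀ i))) (λ z≡t → t≢z (≡.sym z≡t)))) back
      where
      back : (w ∙ gen i) ∙ gen i ≈ w
      back = cancelʳ (involution i) w

    -- Ascents and P are not decidable, so the finitely many decisions met along the
    -- pregalleries of type t from w are recorded, and both counts are read off them.
    data Tree (w : Carrier) : Word → Set (c ⊔ ℓ ⊔ p) where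
      leaf⁺ : P w → Tree w []
      leaf⁻ : ¬ P w → Tree w []
      up    : ∀ {i t} → LenLt w (w ∙ gen i) → Tree (w ∙ gen i) t → Tree w (i ∷ t)
      down  : ∀ {i t} → LenLt (w ∙ gen i) w → Tree (w ∙ gen i) t → Tree w t → Tree w (i ∷ t)

    tree : ∀ w t → ¬ ¬ Tree w t
    tree w [] = ¬¬-excluded-middle >>= λ where
      (yes h) → pure (leaf⁺ h)
      (no h)  → pure (leaf⁻ h)
    tree w (i ∷ t) = tree (w ∙ gen i) t >>= λ T → ascent-or-descent w i >>= λ where
      (inj₁ lt) → pure (up lt T)
      (inj₂ lt) → tree w t >>= λ T′ → pure (down lt T T′)

    chambers : ∀ {w t} → Tree w t → Ch → List Ch
    chambers (leaf⁺ _)           y = [ y ]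
    chambers (leaf⁻ _)           y = []
    chambers (up {i} _ T)        y = concatMap (chambers T) (toward y i ∷ others y i)
    chambers (down {i} _ T T′)   y = chambers T (toward y i) ++ concatMap (chambers T′) (others y i)

    prefix : Fin n × Carrier → ℤ → Steps × ℤ → Steps × ℤ
    prefix s k (γ , z) = s ∷ γ , k ℤ.* z

    pregs : ∀ {w t} → Tree w t → List (Steps × ℤ)
    pregs     (leaf⁺ _)         = [ [] , + 1 ]
    pregs     (leaf⁻ _)         = []
    pregs {w} (up {i} _ T)      = map (prefix (i , w ∙ gen i) (+ q i)) (pregs T)
    pregs {w} (down {i} _ T T′) =
      map (prefix (i , w ∙ gen i) (+ 1)) (pregs T) ++ map (prefix (i , w) (+ q i ℤ.- + 1)) (pregs T′)

    length-concatMap : ∀ (f : Ch → List Ch) {k} → (∀ y → + length (f y) ≡ k) →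
                       ∀ ys → + length (concatMap f ys) ≡ + length ys ℤ.* k
    length-concatMap f     h []       = refl
    length-concatMap f {k} h (y ∷ ys) = ≡.trans (cong +_ (List.length-++ (f y)))
      (≡.trans (ℤ.pos-+ (length (f y)) _) (≡.trans (cong₂ ℤ._+_ (h y) (length-concatMap f h ys))
               (≡.sym (ℤ.suc-* (+ length ys) k))))

    sumBy-prefix : ∀ s k xs → sumBy proj₂ (map (prefix s k) xs) ≡ k ℤ.* sumBy proj₂ xs
    sumBy-prefix s k []             = ≡.sym (ℤ.*-zeroʳ k)
    sumBy-prefix s k ((_ , z) ∷ xs) =
      ≡.trans (cong (ℤ._+_ (k ℤ.* z)) (sumBy-prefix s k xs)) (≡.sym (ℤ.*-distribˡ-+ k z _))

    length-chambers : ∀ {w t} (T : Tree w t) y → + length (chambers T y) ≡ sumBy proj₂ (pregs T)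
    length-chambers (leaf⁺ _) y = refl
    length-chambers (leaf⁻ _) y = refl
    length-chambers {w} (up {i} _ T) y = ≡.trans (length-concatMap (chambers T) (length-chambers T) (toward y i ∷ others y i))
      (≡.trans (cong (λ k → + k ℤ.* sumBy proj₂ (pregs T)) (Panel.size (panel y i)))
               (≡.sym (sumBy-prefix _ (+ q i) (pregs T))))
    length-chambers {w} (down {i} _ T T′) y = ≡.trans
      (≡.trans (cong +_ (List.length-++ (chambers T (toward y i)))) (ℤ.pos-+ (length (chambers T (toward y i))) _))
      (≡.trans (cong₂ ℤ._+_
        (≡.trans (length-chambers T (toward y i)) (≡.sym (≡.trans (sumBy-prefix _ (+ 1) (pregs T)) (ℤ.*-identityˡ _))))
        (≡.trans (length-concatMap (chambers T′) (length-chambers T′) (others y i))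
          -- The integer `+ length (others y i)` is, by computation, `+ suc (length (others y i))`
          -- minus one.
          (≡.trans (cong (λ k → (+ k ℤ.- + 1) ℤ.* sumBy proj₂ (pregs T′)) (Panel.size (panel y i)))
                   (≡.sym (sumBy-prefix _ (+ q i ℤ.- + 1) (pregs T′))))))
      (≡.sym (sumBy-++ proj₂ (map (prefix (i , w ∙ gen i) (+ 1)) (pregs T)) _)))

    -- The ends of the galleries, each listed once

    others-dist : ∀ {w y i} → LenLt (w ∙ gen i) w → dist y ≈ w → All (λ z → dist z ≈ w) (others y i)
    others-dist {y = y} {i} lt e with Panel.unique (panel y i) | Panel.adjacent (panel y i)
    ... | t≢ ∷ _ | _ ∷ adj = All.zipWith (λ (t≢z , h) → dist-other lt e h t≢z) (t≢ , adj)

    panel-dist : ∀ {w y i} → LenLt w (w ∙ gen i) → dist y ≈ w →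
                 All (λ z → dist z ≈ w ∙ gen i) (toward y i ∷ others y i)
    panel-dist {y = y} {i} lt e = All.map (dist-ascent lt e) (Panel.adjacent (panel y i))

    Target : Ch → Word → Ch → Set _
    Target y t z = δ y z ≈ eval t × P (dist z)

    extend : ∀ {y y′ z i t} → Minimal (i ∷ t) → δ y′ y ≈ gen i → Target y′ t z → Target y (i ∷ t) z
    extend {y′ = y′} {t = t} min h (e , pz) = gallery⇒δ min (y′ , h , δ⇒gallery t e) , pz

    all-concatMap : ∀ {r} {R : Ch → Set r} {f : Ch → List Ch} {ys} → All (λ y → All R (f y)) ys → All R (concatMap f ys)
    all-concatMap h = All.concat⁺ (All.map⁺ h)

    chambers-sound : ∀ {w t} (T : Tree w t) {y} → Minimal t → dist y ≈ w → All (Target y t) (chambers T y)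
    chambers-sound (leaf⁺ h) {y} _ e = (δ-refl y , P-resp (sym e) h) ∷ []
    chambers-sound (leaf⁻ _)     _ _ = []
    chambers-sound (up {i} lt T) {y} min e = all-concatMap (All.zipWith
      (λ (h , e′) → All.map (extend min h) (chambers-sound T (minimal-tail min) e′))
      (Panel.adjacent (panel y i) , panel-dist lt e))
    chambers-sound (down {i} lt T T′) {y} min e with Panel.adjacent (panel y i)
    ... | h ∷ hs = All.++⁺ (All.map (extend min h) (chambers-sound T (minimal-tail min) (dist-toward e)))
      (all-concatMap (All.zipWith
        (λ (h′ , e′) → All.map (extend min h′) (chambers-sound T′ (minimal-tail min) e′))
        (hs , others-dist lt e)))

    chambers-complete : ∀ {w t} (T : Tree w t) {y z} → dist y ≈ w → Target y t z → z ∈ₗ chambers T y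
    chambers-complete (leaf⁺ _) _ (e , _) = here (≡.sym (δ-ε e))
    chambers-complete (leaf⁻ ¬h) e (e′ , pz) with refl ← δ-ε e′ = contradiction (P-resp e pz) ¬h
    -- The first chamber of the gallery from `y` to `z` comes from `wd3`; its place in the panel
    -- decides which branch of the tree continues.
    chambers-complete {t = i ∷ t} T {y} {z} e (e′ , pz) with wd3 y z i
    ... | y′ , h , f = split T (Panel.complete (panel y i) h)
      where
      target : Target y′ t z
      target = trans f (trans (∙-congˡ e′) (gen-cancelˡ i _)) , pz

      split : (T : Tree _ (i ∷ t)) → y′ ∈ₗ toward y i ∷ others y i → z ∈ₗ chambers T y
      split (up lt T) y′∈ = ∈-concatMap⁺ (chambers T) (lose y′∈
        (chambers-complete T (dist-ascent lt e h) target))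
      split (down lt T T′) (here refl) = ∈-++⁺ˡ (chambers-complete T (dist-toward e) target)
      split (down lt T T′) (there y′∈) = ∈-++⁺ʳ (chambers T (toward y i)) (∈-concatMap⁺ (chambers T′) (lose y′∈
        (chambers-complete T′ (All.lookup (others-dist lt e) y′∈) target)))

    -- Two such chambers are i-adjacent to each other. From one at distance `eval t`, the ascent s
    -- puts the other at s · `eval t`. This is the uniqueness of a gallery of reduced type with
    -- given ends.
    targets-disjoint : ∀ {y y′ y″ z i t} → Minimal (i ∷ t) → δ y′ y ≈ gen i → δ y″ y ≈ gen i → ¬ y′ ≡ y″ →
                       δ y′ z ≈ eval t → δ y″ z ≈ eval t → ⊥
    targets-disjoint {y′ = y′} {y″} {z} {i} {t} min h h′ y′≢y″ e e′ = LenLt-asym lt (LenLt-resp same (sym same) lt)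
      where
      lt : LenLt (eval t) (gen i ∙ eval t)
      lt = minimal⇒LenLt min

      same : eval t ≈ gen i ∙ eval t
      same = trans (sym e) (trans (proj₂ (wd2 y″ z y′ i (panel-mates h h′ y′≢y″))
               (LenLt-resp (sym e′) (∙-congˡ (sym e′)) lt)) (∙-congˡ e′))

    chambers-disjoint : ∀ {w w′ y y′ y″ i t} (T : Tree w t) (T′ : Tree w′ t) → Minimal (i ∷ t) →
                        δ y′ y ≈ gen i → δ y″ y ≈ gen i → ¬ y′ ≡ y″ → dist y′ ≈ w → dist y″ ≈ w′ →
                        Disjoint (chambers T y′) (chambers T′ y″)
    chambers-disjoint T T′ min h h′ y′≢y″ e e′ (z∈ , z∈′) = targets-disjoint min h h′ y′≢y″
      (proj₁ (All.lookup (chambers-sound T (minimal-tail min) e) z∈))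
      (proj₁ (All.lookup (chambers-sound T′ (minimal-tail min) e′) z∈′))

    concatMap-unique : ∀ {w y i t ys} (T : Tree w t) → Minimal (i ∷ t) → Unique ys →
                       All (λ z → δ z y ≈ gen i) ys → All (λ z → dist z ≈ w) ys →
                       All (λ z → Unique (chambers T z)) ys → Unique (concatMap (chambers T) ys)
    concatMap-unique {w} {y} {i} T min ds hs es us =
      Unique.concat⁺ (All.map⁺ us) (AllPairs.map⁺ (pairs ds hs es))
      where
      all : ∀ {y′ ys} → δ y′ y ≈ gen i → dist y′ ≈ w → All (λ z → ¬ y′ ≡ z) ys → All (λ z → δ z y ≈ gen i) ys →
            All (λ z → dist z ≈ w) ys → All (λ z → Disjoint (chambers T y′) (chambers T z)) ys
      all h e []       []         []         = []
      all h e (d ∷ ds) (h′ ∷ hs′) (e′ ∷ es′) = chambers-disjoint T T min h h′ d e e′ ∷ all h e ds hs′ es′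

      pairs : ∀ {ys} → Unique ys → All (λ z → δ z y ≈ gen i) ys → All (λ z → dist z ≈ w) ys →
              AllPairs (λ y′ y″ → Disjoint (chambers T y′) (chambers T y″)) ys
      pairs []       []       []       = []
      pairs (d ∷ ds) (h ∷ hs) (e ∷ es) = all h e d hs es ∷ pairs ds hs es

    chambers-unique : ∀ {w t} (T : Tree w t) {y} → Minimal t → dist y ≈ w → Unique (chambers T y)
    chambers-unique (leaf⁺ _) _ _ = [] ∷ []
    chambers-unique (leaf⁻ _) _ _ = []
    chambers-unique (up {i} lt T) {y} min e = concatMap-unique T min
      (Panel.unique (panel y i)) (Panel.adjacent (panel y i)) (panel-dist lt e)
      (All.map (chambers-unique T (minimal-tail min)) (panel-dist lt e))
    chambers-unique (down {i} lt T T′) {y} min e with Panel.unique (panel y i) | Panel.adjacent (panel y i)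
    ... | d ∷ ds | h ∷ hs = Unique.++⁺ (chambers-unique T (minimal-tail min) (dist-toward e))
      (concatMap-unique T′ min ds hs (others-dist lt e)
        (All.map (chambers-unique T′ (minimal-tail min)) (others-dist lt e)))
      λ (z∈ , z∈′) → case find (∈-concatMap⁻ (chambers T′) z∈′) of λ (y′ , y′∈ , z∈″) →
        chambers-disjoint T T′ min h (All.lookup hs y′∈) (All.lookup d y′∈)
          (dist-toward e) (All.lookup (others-dist lt e) y′∈) (z∈ , z∈″)

    -- The pregalleries recorded by a tree

    pregs-sound : ∀ {w t} (T : Tree w t) →
                  All (λ (γ , z) → PregW w γ z × type γ ≡ t × P (endP w γ)) (pregs T)
    pregs-sound (leaf⁺ h) = (done , refl , h) ∷ []
    pregs-sound (leaf⁻ _) = []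
    pregs-sound (up lt T) = All.map⁺ (All.map
      (λ (γ , e , h) → step (up ≈-refl lt) γ , cong (_ ∷_) e , h) (pregs-sound T))
    pregs-sound (down lt T T′) = All.++⁺
      (All.map⁺ (All.map (λ (γ , e , h) → step (down ≈-refl lt) γ , cong (_ ∷_) e , h) (pregs-sound T)))
      (All.map⁺ (All.map (λ (γ , e , h) → step (stay ≈-refl lt) γ , cong (_ ∷_) e , h) (pregs-sound T′)))

    LenLt-irrefl : ∀ {x y} → x ≈ y → LenLt x y → ⊥
    LenLt-irrefl e lt = LenLt-asym lt (LenLt-resp e (sym e) lt)

    -- Steps are determined only up to ≈, hence the separate start `w₀`. At an ascent only `up` is
    -- legal, at a descent only `stay` and `down`, matching the branches of the tree.
    pregs-complete : ∀ {w w₀ t γ z} (T : Tree w t) → w₀ ≈ w → PregW w₀ γ z → type γ ≡ t → P (endP w₀ γ) →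
                     Any (λ p → PregEq γ (proj₁ p)) (pregs T)
    pregs-complete (leaf⁺ _)  e done refl _ = here []
    pregs-complete (leaf⁻ ¬h) e done refl h = contradiction (P-resp e h) ¬h
    pregs-complete (up lt T) e (step s γ) refl h = case s of λ where
      (up f _)      → Any.map⁺ (Any.map ((refl , trans f (∙-congʳ e)) ∷_)
                        (pregs-complete T (trans f (∙-congʳ e)) γ refl h))
      (stay _ lt′)  → ⊥-elim (LenLt-asym lt (LenLt-resp (∙-congʳ e) e lt′))
      (down f lt′)  → ⊥-elim (LenLt-asym lt (LenLt-resp (trans f (∙-congʳ e)) e lt′))
    pregs-complete (down lt T T′) e (step s γ) refl h = case s of λ where
      (up f lt′)   → ⊥-elim (LenLt-asym lt (LenLt-resp e (trans f (∙-congʳ e)) lt′))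
      (stay f _)   → Any.++⁺ʳ _ (Any.map⁺ (Any.map ((refl , trans f e) ∷_)
                       (pregs-complete T′ (trans f e) γ refl h)))
      (down f _)   → Any.++⁺ˡ (Any.map⁺ (Any.map ((refl , trans f (∙-congʳ e)) ∷_)
                       (pregs-complete T (trans f (∙-congʳ e)) γ refl h)))

    PregDistinct : Steps × ℤ → Steps × ℤ → Set _
    PregDistinct p p′ = ¬ PregEq (proj₁ p) (proj₁ p′)

    pregs-distinct : ∀ {w t} (T : Tree w t) → AllPairs PregDistinct (pregs T)
    pregs-distinct (leaf⁺ _) = [] ∷ []
    pregs-distinct (leaf⁻ _) = []
    pregs-distinct (up lt T) = AllPairs.map⁺ (AllPairs.map (λ { d (_ ∷ e) → d e }) (pregs-distinct T))
    pregs-distinct (down lt T T′) = AllPairs.++⁺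
      (AllPairs.map⁺ (AllPairs.map (λ { d (_ ∷ e) → d e }) (pregs-distinct T)))
      (AllPairs.map⁺ (AllPairs.map (λ { d (_ ∷ e) → d e }) (pregs-distinct T′)))
      -- The two families differ at their first step, one going to ws and the other staying at w.
      (All.map⁺ (All.universal (λ _ → All.map⁺ (All.universal
        (λ { _ ((_ , e) ∷ _) → LenLt-irrefl e lt }) (pregs T′))) (pregs T)))

    stepW-weight : ∀ {w w′ v v′ i a a′} → w ≈ w′ → v ≈ v′ → StepW w i v a → StepW w′ i v′ a′ → a ≡ a′
    stepW-weight e f (up _ _)     (up _ _)      = refl
    stepW-weight e f (up _ lt)    (stay g _)    = ⊥-elim (LenLt-irrefl (trans e (sym (trans f g))) lt)
    stepW-weight e f (up _ lt)    (down _ lt′)  = ⊥-elim (LenLt-asym lt (LenLt-resp (sym f) (sym e) lt′))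
    stepW-weight e f (stay g _)   (up _ lt′)    = ⊥-elim (LenLt-irrefl (trans (sym e) (trans (sym g) f)) lt′)
    stepW-weight e f (stay _ _)   (stay _ _)    = refl
    stepW-weight e f (stay g _)   (down _ lt′)  = ⊥-elim (LenLt-irrefl (trans (sym f) (trans g e)) lt′)
    stepW-weight e f (down _ lt)  (up _ lt′)    = ⊥-elim (LenLt-asym lt (LenLt-resp (sym e) (sym f) lt′))
    stepW-weight e f (down _ lt)  (stay g _)    = ⊥-elim (LenLt-irrefl (trans f (trans g (sym e))) lt)
    stepW-weight e f (down _ _)   (down _ _)    = refl

    -- Comparing lengths determines the kind of every step, so the weight does not depend on the
    -- ≈-representatives in which a pregallery is listed.
    pregW-weight : ∀ {w w′ γ γ′ z z′} → w ≈ w′ → PregEq γ γ′ → PregW w γ z → PregW w′ γ′ z′ → z ≡ z′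
    pregW-weight e []               done       done         = refl
    pregW-weight e ((refl , f) ∷ g) (step s γ) (step s′ γ′) =
      cong₂ ℤ._*_ (stepW-weight e f s s′) (pregW-weight f g γ γ′)

    pregEq-sym : ∀ {γ γ′} → PregEq γ γ′ → PregEq γ′ γ
    pregEq-sym = Pointwise.symmetric λ (e , f) → ≡.sym e , sym f

    pregEq-trans : ∀ {γ γ′ γ″} → PregEq γ γ′ → PregEq γ′ γ″ → PregEq γ γ″
    pregEq-trans = Pointwise.transitive λ (e , f) (e′ , f′) → ≡.trans e e′ , trans f f′

    pregEq-type : ∀ {γ γ′} → PregEq γ γ′ → type γ ≡ type γ′
    pregEq-type []             = refl
    pregEq-type ((e , _) ∷ es) = cong₂ _∷_ e (pregEq-type es)

    -- All words 𝐦𝐯 together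

    Forest : Carrier → List Word → Set _
    Forest w = All (Tree w)

    forest : ∀ w ts → ¬ ¬ Forest w ts
    forest w ts = ¬¬-All (All.universal (tree w) ts)

    chambersF : ∀ {w ts} → Forest w ts → Ch → List Ch
    chambersF []      y = []
    chambersF (T ∷ F) y = chambers T y ++ chambersF F y

    pregsF : ∀ {w ts} → Forest w ts → List (Steps × ℤ)
    pregsF []      = []
    pregsF (T ∷ F) = pregs T ++ pregsF F

    length-chambersF : ∀ {w ts} (F : Forest w ts) y → + length (chambersF F y) ≡ sumBy proj₂ (pregsF F)
    length-chambersF []      y = refl
    length-chambersF (T ∷ F) y = ≡.trans (cong +_ (List.length-++ (chambers T y)))
      (≡.trans (ℤ.pos-+ (length (chambers T y)) _) (≡.trans (cong₂ ℤ._+_ (length-chambers T y) (length-chambersF F y))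
               (≡.sym (sumBy-++ proj₂ (pregs T) (pregsF F)))))

    TargetF : Ch → List Word → Ch → Set _
    TargetF y ts z = Any (λ t → δ y z ≈ eval t) ts × P (dist z)

    chambersF-sound : ∀ {w ts} (F : Forest w ts) {y} → All Minimal ts → dist y ≈ w → All (TargetF y ts) (chambersF F y)
    chambersF-sound []      []         e = []
    chambersF-sound (T ∷ F) (min ∷ ms) e = All.++⁺
      (All.map (λ (f , h) → here f , h) (chambers-sound T min e))
      (All.map (λ (f , h) → there f , h) (chambersF-sound F ms e))

    chambersF-complete : ∀ {w ts} (F : Forest w ts) {y z} → dist y ≈ w → TargetF y ts z → z ∈ₗ chambersF F y
    chambersF-complete (T ∷ F)     e (here f , h)  = ∈-++⁺ˡ (chambers-complete T e (f , h))
    chambersF-complete (T ∷ F) {y} e (there f , h) = ∈-++⁺ʳ (chambers T y) (chambersF-complete F e (f , h))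

    DistinctValues : List Word → Set _
    DistinctValues = AllPairs (λ t t′ → ¬ eval t ≈ eval t′)

    -- The value of a word is the distance from `y` to the chambers it contributes, so different
    -- values contribute disjoint lists.
    chambersF-unique : ∀ {w ts} (F : Forest w ts) {y} → All Minimal ts → DistinctValues ts → dist y ≈ w →
                       Unique (chambersF F y)
    chambersF-unique []      []         []       e = []
    chambersF-unique (T ∷ F) (min ∷ ms) (d ∷ ds) e = Unique.++⁺ (chambers-unique T min e) (chambersF-unique F ms ds e)
      λ (z∈ , z∈′) → case All.lookupAny d (proj₁ (All.lookup (chambersF-sound F ms e) z∈′)) of λ (t≉t′ , f) →
        t≉t′ (trans (sym (proj₁ (All.lookup (chambers-sound T min e) z∈))) f)

    pregsF-sound : ∀ {w ts} (F : Forest w ts) →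
                   All (λ (γ , z) → PregW w γ z × type γ ∈ₗ ts × P (endP w γ)) (pregsF F)
    pregsF-sound []      = []
    pregsF-sound (T ∷ F) = All.++⁺ (All.map (λ (γ , e , h) → γ , here e , h) (pregs-sound T))
                                   (All.map (λ (γ , e , h) → γ , there e , h) (pregsF-sound F))

    pregsF-complete : ∀ {w ts γ z} (F : Forest w ts) → PregW w γ z → type γ ∈ₗ ts → P (endP w γ) →
                      Any (λ p → PregEq γ (proj₁ p)) (pregsF F)
    pregsF-complete (T ∷ F) γ (here e)  h = Any.++⁺ˡ (pregs-complete T ≈-refl γ e h)
    pregsF-complete (T ∷ F) γ (there e) h = Any.++⁺ʳ (pregs T) (pregsF-complete F γ e h)

    pregsF-distinct : ∀ {w ts} (F : Forest w ts) → DistinctValues ts → AllPairs PregDistinct (pregsF F)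
    pregsF-distinct []      []       = []
    pregsF-distinct {ts = t ∷ ts} (T ∷ F) (d ∷ ds) = AllPairs.++⁺ (pregs-distinct T) (pregsF-distinct F ds)
      (All.map (λ (_ , e , _) → All.map (λ (_ , e′ , _) eq →
          All.lookup d e′ (eval-resp (≡.trans (≡.sym e) (pregEq-type eq))))
        (pregsF-sound F)) (pregs-sound T))

  -- Comparison of the two counts

  module StructureConstants {b : Level} {q : Fin n → ℕ} (X : Building q b) {I J K : Subset n} {u v w : Carrier}
      (vw : Word) (v∈R : InR K J v) (v-reduced : Reduced v vw)
      {ms : List (Carrier × Word)} (ms-reps : MReps K J v ms)
      {A B x₀ y₀ : Building.Ch X} (Ax₀ : Simp.SameSimp X I A x₀) (By₀ : Simp.SameSimp X K B y₀) where
    open Building X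
    open Simp X
    open Galleries X

    P : Carrier → Set _
    P = InDouble I J u

    P-resp : ∀ {x y} → x ≈ y → P x → P y
    P-resp e (y , z , py , pz , f) = y , z , py , pz , trans (sym e) f

    open Representatives vw v∈R v-reduced
    open Counting X x₀ P P-resp

    reps : All IsRep ms
    reps = All.map (λ (h , h′) → rep h h′) (proj₁ ms-reps)

    words : List Word
    words = map (λ p → proj₂ p ++ vw) ms

    words-minimal : All Minimal words
    words-minimal = All.map⁺ (All.map minimal-rep reps)

    words-distinct : DistinctValues words
    words-distinct = AllPairs.map⁺ (AllPairs.map
      (λ (m≉m′ , h , h′) e → m≉m′ (∙-cancelʳ v _ _
        (trans (sym (eval-rep h)) (trans e (eval-rep h′)))))
      (allPairs×all (proj₁ (proj₂ ms-reps)) reps))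

    AtRep : Ch → Set _
    AtRep z = ∃ λ p → IsRep p × δ y₀ z ≈ eval (proj₂ p ++ vw)

    atRep : ∀ {z} → Any (λ t → δ y₀ z ≈ eval t) words → AtRep z
    atRep any = case find (any×all (Any.map⁻ any) reps) of λ (p , _ , e , h) → p , h , e

    -- The correspondence between simplices and their nearest chambers is kept as a relation,
    -- because the chamber is found only up to double negation.
    Meets : Ch → Ch → Set _
    Meets d z = SameSimp J d z × AtRep z

    -- Simplices that share a chamber coincide, by transitivity; nearest chambers of one simplex
    -- coincide, by `rep-unique`.
    length-simplices : ∀ {Ds} (F : Forest w words) → dist y₀ ≈ w → EnumF I J K A B u v Ds →
                       length Ds ≡ length (chambersF F y₀)
    length-simplices {Ds} F e (Ds-sound , Ds-distinct , Ds-complete) = length-match Meets Ds (chambersF F y₀)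
      (AllPairs.map (λ d≁d′ _ (dz , _) (d′z , _) → d≁d′ (same-trans {J} dz (same-sym {J} d′z))) Ds-distinct)
      (AllPairs.map (λ z≢z′ _ (dz , _ , h , f) (dz′ , _ , h′ , f′) →
          rep-unique h h′ (same-trans {J} (same-sym {J} dz) dz′) f f′ z≢z′)
        (chambersF-unique F words-minimal words-distinct e))
      (All.map to-chamber Ds-sound)
      (All.map to-simplex (chambersF-sound F words-minimal e))
      where
      to-chamber : ∀ {d} → DistIs I J A d u × DistIs K J B d v → ¬ ¬ Any (Meets d) (chambersF F y₀)
      to-chamber (du , dv) =
        rep-exists ms-reps By₀ dv >>= λ any →
        case find (any×all any reps) of λ (p , p∈ms , (z , dz , f) , h) →
        distIs⇒inDouble {I} {J} Ax₀ dz du >>= λ hz →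
        pure (lose (chambersF-complete F e (Any.map⁺ (lose p∈ms f) , hz)) (dz , p , h , f))

      to-simplex : ∀ {z} → TargetF y₀ words z → ¬ ¬ Any (λ d → Meets d z) Ds
      to-simplex {z} (any , hz) = case atRep any of λ (p , h , f) →
        inDouble⇒distIs {I} {J} Ax₀ hz >>= λ zu →
        pure (Any.map (λ zd → same-sym {J} zd , p , h , f)
                      (Ds-complete z zu (rep-distIs h By₀ f)))

    open Preg q
    open Sum q

    -- The two `PregW` proofs are part of the relation because matched entries must have equal
    -- weights.
    Matches : Steps × ℤ → Steps × ℤ → Set _
    Matches (γ , z) (γ′ , z′) = PregEq γ γ′ × PregW w γ z × PregW w γ′ z′

    sumBy-pregalleries : ∀ {Γ} (F : Forest w words) → EnumPreg I J u w vw ms Γ →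
                         sumBy proj₂ Γ ≡ sumBy proj₂ (pregsF F)
    sumBy-pregalleries {Γ} F (Γ-sound , Γ-distinct , Γ-complete) = sumBy-match Matches proj₂ proj₂
      (λ (e , h , h′) → pregW-weight ≈-refl e h h′) Γ (pregsF F)
      (AllPairs.map (λ d _ (e , _) (e′ , _) → d (pregEq-trans e (pregEq-sym e′))) Γ-distinct)
      (AllPairs.map (λ d _ (e , _) (e′ , _) → d (pregEq-trans (pregEq-sym e) e′)) (pregsF-distinct F words-distinct))
      (All.map (λ (h , t , hu) → pure (Any.map (λ (e , h′ , _) → e , h , h′)
          (any×all (pregsF-complete F h (Any.map⁺ t) hu) (pregsF-sound F)))) Γ-sound)
      (All.map (λ (h , t , hu) → pure (Any.map (λ (e , h′ , _) → pregEq-sym e , h′ , h)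
          (any×all (Γ-complete _ _ (h , Any.map⁻ t , hu)) Γ-sound))) (pregsF-sound F))

    structureConstant : ∀ {Ds Γ} → δ x₀ y₀ ≈ w → EnumF I J K A B u v Ds → EnumPreg I J u w vw ms Γ →
                        + length Ds ≡ sumBy proj₂ Γ
    structureConstant {Ds} {Γ} e hDs hΓ = decidable-stable (_ ℤ.≟ _) do
      -- This identifies `dist y₀` with w, the common root of the trees.
      inv ← δ-inverse y₀ x₀
      F   ← forest w words
      pure (≡.trans (cong +_ (length-simplices F (trans (sym inv) e) hDs))
           (≡.trans (length-chambersF F y₀) (≡.sym (sumBy-pregalleries F hΓ))))

theorem3p7 : ∀ {c ℓ b : Level} (W : Group c ℓ) (n : ℕ) (gen : Fin n → Group.Carrier W)
    → Cox.IsCoxeterSystem W gen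
    → (q : Fin n → ℕ) (X : Cox.Building W gen q b)
    → (I J K : Subset n)
    → Cox.Spherical W gen I → Cox.Spherical W gen J → Cox.Spherical W gen K
    → (u v w : Group.Carrier W)
    → Cox.InR W gen I J u → Cox.InR W gen K J v → Cox.InR W gen I K w
    → (vw : Cox.Word W gen) → Cox.Reduced W gen v vw
    → (ms : List (Group.Carrier W × Cox.Word W gen)) → Cox.MReps W gen K J v ms
    → (A B : Cox.Building.Ch X) → Cox.Simp.DistIs W gen X I K A B w
    → (Ds : List (Cox.Building.Ch X)) → Cox.Simp.EnumF W gen X I J K A B u v Ds
    → (Γ : List (Cox.Steps W gen × ℤ)) → Cox.Sum.EnumPreg W gen q I J u w vw ms Γ
    → + length Ds ≡ Cox.sumℤ W gen (map proj₂ Γ)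
theorem3p7 W n gen cox q X I J K _ _ _ u v w _ v∈R _ vw v-reduced ms ms-reps A B
           (x₀ , y₀ , Ax₀ , By₀ , δ≈w) Ds hDs Γ hΓ =
  Coxeter.StructureConstants.structureConstant W gen cox X vw v∈R v-reduced ms-reps Ax₀ By₀ δ≈w hDs hΓ
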